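{- For any fence $F$, $\dim I_H(F)=\dim A_H(F)$.
   Context: A fence $\breve F(\alpha_1,\dots,\alpha_t)$ ($t\ge2$, positive integers, $\alpha_1,\alpha_t\ge2$) is the poset on $\{x_1,\dots,x_n\}$, $n=\alpha_1+\dots+\alpha_t-1$, with $a_i=\alpha_1+\dots+\alpha_i$, $a_0=0$, whose cover relations are: for $1\le j\le n-1$ with $a_{i-1}\le j<a_i$, $x_j\lessdot x_{j+1}$ if $i$ odd and $x_j\gtrdot x_{j+1}$ if $i$ even. $\mathcal J(F)$ is the set of order ideals; rowmotion $\rho$ sends $I$ to the order ideal generated by $\min(F\setminus I)$. A statistic $f:\mathcal J(F)\to\mathbb R$ is homomesic under rowmotion if its average over every $\rho$-orbit is the same constant. $\hat\chi_q(I)=1$ if $q\in I$, else 0; $\chi_q(I)=1$ if $q\in\max(I)$, else 0. $I_H(F)$ (resp. $A_H(F)$) is the subspace of $\operatorname{Span}_{\mathbb R}\{\hat\chi_q:q\in F\}$ (resp. $\operatorname{Span}_{\mathbb R}\{\chi_q:q\in F\}$) consisting of statistics homomesic under rowmotion. -}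

module Defs where

open import Algebra.Apartness.Bundles using (HeytingField; HeytingCommutativeRing)
open import Algebra.Bundles using (CommutativeRing)
open import Data.Bool.Base using (if_then_else_)
open import Data.Empty using (⊥-elim)
open import Data.Fin.Base using (Fin; toℕ)
open import Data.Fin.Properties using (any?; all?; toℕ<n) renaming (_≟_ to _≟ᶠ_)
open import Data.Fin.Subset using (Subset; _∈_)
open import Data.Fin.Subset.Properties using (_∈?_)
open import Data.List.Base as List using (List)
import Data.List.Membership.Propositional as ListMem
open import Data.List.NonEmpty as List⁺ using (List⁺)
open import Data.List.Relation.Unary.Unique.Propositional using (Unique)
open import Data.Nat.Base
  using (ℕ; zero; suc; _∸_; _≤_; _<_; z≤n; s≤s; parity)
  renaming (_+_ to _+ℕ_)
open import Data.Nat.GeneralisedArithmetic using (iterate)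
open import Data.Nat.Induction using (<-wellFounded)
open import Data.Nat.ListAction using () renaming (sum to sumℕ)
open import Data.Nat.Properties
open import Data.Parity.Base using (Parity; 0ℙ; 1ℙ)
import Data.Parity.Properties as Parity
open import Data.Product.Base using (Σ; ∃-syntax; _×_; _,_; proj₁; proj₂)
open import Data.Sum.Base using (_⊎_; inj₁; inj₂)
open import Data.Vec.Base as Vec using (Vec; tabulate; toList)
open import Data.Vec.Properties using (lookup∘tabulate; []=⇒lookup; lookup⇒[]=)
open import Data.Vec.Relation.Unary.All using (All)
open import Function.Base using (_∘_)
open import Function.Bundles using (_⇔_)
open import Induction.WellFounded using (Acc; acc)
open import Level using (Level; 0ℓ; _⊔_)
open import Relation.Binary.Construct.Closure.ReflexiveTransitive using (Star; ε; _◅_; _◅◅_)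
open import Relation.Binary.Definitions using (tri<; tri≈; tri>)
open import Relation.Binary.PropositionalEquality
  using (_≡_; _≢_; refl; sym; trans; cong; cong₂; subst)
open import Relation.Nullary.Decidable
  using (Dec; yes; no; does; map′; _×-dec_; _⊎-dec_; _→-dec_; ¬?; dec-true)
open import Relation.Nullary.Negation.Core using (¬_)
open import Relation.Unary using (Pred; Decidable)

-- The fence F̆(α₁,…,α_t), with t = 2 + t-2.
record Fence : Set where
  field
    t-2      : ℕ
    α        : Vec ℕ (2 +ℕ t-2)
    positive : All (1 ≤_) α
    first≥2  : 2 ≤ Vec.head α
    last≥2   : 2 ≤ Vec.last α

module _ (F : Fence) where
  open Fence F

  t : ℕ
  t = 2 +ℕ t-2

  -- a i = α₁ + … + αᵢ
  a : ℕ → ℕ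
  a i = sumℕ (List.take i (toList α))

  size : ℕ
  size = a t ∸ 1

  -- The element xⱼ (1 ≤ j ≤ size) is the one with index x ≡ j.
  Element : Set
  Element = Fin size

  index : Element → ℕ
  index x = suc (toℕ x)

  -- a_{i-1} ≤ j < a_i for some 1 ≤ i ≤ t of parity p, where i = suc k.
  Segment : Parity → ℕ → Set
  Segment p j = ∃[ k ] (parity (suc (toℕ {t} k)) ≡ p × a (toℕ k) ≤ j × j < a (suc (toℕ k)))

  infix 4 _⋖_
  data _⋖_ : Element → Element → Set where
    odd  : ∀ {x y} → index y ≡ suc (index x) → Segment 1ℙ (index x) → x ⋖ y
    even : ∀ {x y} → index y ≡ suc (index x) → Segment 0ℙ (index x) → y ⋖ x

  infix 4 _⊑_
  _⊑_ : Element → Element → Set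
  _⊑_ = Star _⋖_

  -- Each cover step upwards decreases rank below, which makes the search in
  -- _⊑?_ terminate.
  segment? : ∀ p j → Dec (Segment p j)
  segment? p j = any? λ k →
    (parity (suc (toℕ k)) Parity.≟ p) ×-dec (a (toℕ k) ≤? j) ×-dec (j <? a (suc (toℕ k)))

  infix 4 _⋖?_
  _⋖?_ : ∀ x y → Dec (x ⋖ y)
  x ⋖? y = map′ to from
    (((index y ≟ suc (index x)) ×-dec segment? 1ℙ (index x)) ⊎-dec
     ((index x ≟ suc (index y)) ×-dec segment? 0ℙ (index y)))
    where
    Cases : Set
    Cases = (index y ≡ suc (index x) × Segment 1ℙ (index x)) ⊎
            (index x ≡ suc (index y) × Segment 0ℙ (index y))
    to : Cases → x ⋖ y
    to (inj₁ (e , s)) = odd e s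
    to (inj₂ (e , s)) = even e s
    from : x ⋖ y → Cases
    from (odd e s)  = inj₁ (e , s)
    from (even e s) = inj₂ (e , s)

  a-mono : ∀ {i j} → i ≤ j → a i ≤ a j
  a-mono = go (toList α)
    where
    go : ∀ (xs : List ℕ) {i j} → i ≤ j → sumℕ (List.take i xs) ≤ sumℕ (List.take j xs)
    go xs          z≤n     = z≤n
    go List.[]     (s≤s p) = z≤n
    go (x List.∷ xs) (s≤s p) = +-monoʳ-≤ x (go xs p)

  segment-unique : ∀ {j p q} → Segment p j → Segment q j → p ≡ q
  segment-unique (k , refl , l , u) (k′ , refl , l′ , u′) with <-cmp (toℕ k) (toℕ k′)
  ... | tri≈ _ e _ = cong (parity ∘ suc) e
  ... | tri< k<k′ _ _ = ⊥-elim (<-irrefl refl (<-≤-trans u (≤-trans (a-mono k<k′) l′)))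
  ... | tri> _ _ k′<k = ⊥-elim (<-irrefl refl (<-≤-trans u′ (≤-trans (a-mono k′<k) l)))

  private
    countYes countNo : ∀ {P : Set} → Dec P → ℕ → ℕ
    countYes P? m = if does P? then suc m else m
    countNo  P? m = if does P? then m else suc m

    countYes≤ : ∀ {P : Set} (P? : Dec P) m → countYes P? m ≤ suc m
    countYes≤ (yes _) m = ≤-refl
    countYes≤ (no _)  m = n≤1+n m

    ups downs : ℕ → ℕ
    ups zero      = 0
    ups (suc j)   = countYes (segment? 1ℙ (suc j)) (ups j)
    downs zero    = 0
    downs (suc j) = countNo (segment? 1ℙ (suc j)) (downs j)

    ups≤ : ∀ j → ups j ≤ j
    ups≤ zero    = z≤n
    ups≤ (suc j) = ≤-trans (countYes≤ (segment? 1ℙ (suc j)) (ups j)) (s≤s (ups≤ j))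

    rankℕ : ℕ → ℕ
    rankℕ j = (size ∸ ups j) +ℕ downs j

    rank : Element → ℕ
    rank = rankℕ ∘ toℕ

    countYes-yes : ∀ {P : Set} (P? : Dec P) → P → ∀ m → countYes P? m ≡ suc m
    countYes-yes (yes _) _ m = refl
    countYes-yes (no ¬p) p m = ⊥-elim (¬p p)

    countYes-no : ∀ {P : Set} (P? : Dec P) → ¬ P → ∀ m → countYes P? m ≡ m
    countYes-no (yes p) ¬p m = ⊥-elim (¬p p)
    countYes-no (no _)  _  m = refl

    countNo-yes : ∀ {P : Set} (P? : Dec P) → P → ∀ m → countNo P? m ≡ m
    countNo-yes (yes _) _ m = refl
    countNo-yes (no ¬p) p m = ⊥-elim (¬p p)

    countNo-no : ∀ {P : Set} (P? : Dec P) → ¬ P → ∀ m → countNo P? m ≡ suc m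
    countNo-no (yes p) ¬p m = ⊥-elim (¬p p)
    countNo-no (no _)  _  m = refl

    rank-odd : ∀ {j} → j < size → Segment 1ℙ (suc j) → rankℕ (suc j) < rankℕ j
    rank-odd {j} j<n s = subst (_< rankℕ j)
      (sym (cong₂ (λ u d → (size ∸ u) +ℕ d)
        (countYes-yes (segment? 1ℙ (suc j)) s (ups j))
        (countNo-yes (segment? 1ℙ (suc j)) s (downs j))))
      (+-monoˡ-< (downs j) (∸-monoʳ-< (n<1+n (ups j)) (≤-trans (s≤s (ups≤ j)) j<n)))

    0ℙ≢1ℙ : 0ℙ ≢ 1ℙ
    0ℙ≢1ℙ ()

    rank-even : ∀ {j} → Segment 0ℙ (suc j) → rankℕ j < rankℕ (suc j)
    rank-even {j} s = subst (rankℕ j <_)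
      (sym (cong₂ (λ u d → (size ∸ u) +ℕ d)
        (countYes-no (segment? 1ℙ (suc j)) ¬odd (ups j))
        (countNo-no (segment? 1ℙ (suc j)) ¬odd (downs j))))
      (+-monoʳ-< (size ∸ ups j) (n<1+n (downs j)))
      where
      ¬odd : ¬ Segment 1ℙ (suc j)
      ¬odd s′ = 0ℙ≢1ℙ (segment-unique s s′)

    rank-⋖ : ∀ {x y} → x ⋖ y → rank y < rank x
    rank-⋖ {x} {y} (odd e s) =
      subst (λ j → rankℕ j < rank x) (sym (suc-injective e)) (rank-odd (toℕ<n x) s)
    rank-⋖ {y} {x} (even e s) =
      subst (λ j → rank x < rankℕ j) (sym (suc-injective e)) (rank-even s)

  infix 4 _⊑?_
  _⊑?_ : ∀ x y → Dec (x ⊑ y)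
  x ⊑? y = go x (<-wellFounded (rank x))
    where
    go : ∀ x → Acc _<_ (rank x) → Dec (x ⊑ y)
    go x (acc rs) with x ≟ᶠ y
    ... | yes refl = yes ε
    ... | no x≢y   = map′ to from (any? step)
      where
      step : ∀ z → Dec (Σ (x ⋖ z) λ _ → z ⊑ y)
      step z with x ⋖? z
      ... | no ¬c = no (¬c ∘ proj₁)
      ... | yes c = map′ (c ,_) proj₂ (go z (rs (rank-⋖ c)))
      to : (∃[ z ] Σ (x ⋖ z) λ _ → z ⊑ y) → x ⊑ y
      to (_ , c , p) = c ◅ p
      from : x ⊑ y → ∃[ z ] Σ (x ⋖ z) λ _ → z ⊑ y
      from ε       = ⊥-elim (x≢y refl)
      from (c ◅ p) = _ , c , p

  -- Irrelevance of the closure proof makes ideals with the same elements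
  -- propositionally equal.
  record OrderIdeal : Set where
    constructor ideal
    field
      set         : Subset size
      .downClosed : ∀ {x y} → x ⊑ y → y ∈ set → x ∈ set

  open OrderIdeal public

  Maximal : Pred Element 0ℓ → Element → Set
  Maximal S x = S x × (∀ y → S y → x ⊑ y → x ≡ y)

  Minimal : Pred Element 0ℓ → Element → Set
  Minimal S x = S x × (∀ y → S y → y ⊑ x → x ≡ y)

  maximal? : ∀ {S} → Decidable S → Decidable (Maximal S)
  maximal? S? x = S? x ×-dec all? λ y → S? y →-dec ((x ⊑? y) →-dec (x ≟ᶠ y))

  minimal? : ∀ {S} → Decidable S → Decidable (Minimal S)
  minimal? S? x = S? x ×-dec all? λ y → S? y →-dec ((y ⊑? x) →-dec (x ≟ᶠ y))

  ⟦_⟧ : ∀ {P : Pred Element 0ℓ} → Decidable P → Subset size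
  ⟦ P? ⟧ = tabulate (does ∘ P?)

  ∈⟦⟧⁺ : ∀ {P : Pred Element 0ℓ} (P? : Decidable P) {x} → P x → x ∈ ⟦ P? ⟧
  ∈⟦⟧⁺ P? {x} p = lookup⇒[]= x _ (trans (lookup∘tabulate _ x) (dec-true (P? x) p))

  ∈⟦⟧⁻ : ∀ {P : Pred Element 0ℓ} (P? : Decidable P) {x} → x ∈ ⟦ P? ⟧ → P x
  ∈⟦⟧⁻ P? {x} x∈ with P? x | trans (sym (lookup∘tabulate (does ∘ P?) x)) ([]=⇒lookup x∈)
  ... | yes p | _ = p
  ... | no _  | ()

  GeneratedBy : Pred Element 0ℓ → Element → Set
  GeneratedBy S x = ∃[ y ] (S y × x ⊑ y)

  generatedBy? : ∀ {S} → Decidable S → Decidable (GeneratedBy S)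
  generatedBy? S? x = any? λ y → S? y ×-dec (x ⊑? y)

  ⟨_⟩ : ∀ {S} → Decidable S → OrderIdeal
  ⟨ S? ⟩ = ideal ⟦ generatedBy? S? ⟧ λ x⊑y y∈ →
    let (z , z∈S , y⊑z) = ∈⟦⟧⁻ (generatedBy? S?) y∈
    in  ∈⟦⟧⁺ (generatedBy? S?) (z , z∈S , x⊑y ◅◅ y⊑z)

  ρ : OrderIdeal → OrderIdeal
  ρ I = ⟨ minimal? (λ x → ¬? (x ∈? set I)) ⟩

  -- O lists every element of some ρ-orbit exactly once. Forward iterates
  -- suffice, since ρ is a bijection of a finite set.
  IsOrbit : List⁺ OrderIdeal → Set
  IsOrbit O = Unique (List⁺.toList O) ×
    ∃[ I ] (∀ J → (J ListMem.∈ List⁺.toList O) ⇔ (∃[ k ] (iterate ρ I k ≡ J)))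

-- The real scalars are generalised to an arbitrary Heyting field K of
-- characteristic zero; every construction of ℝ is an instance, as is ℚ.
module _ {c ℓ₁ ℓ₂ : Level} (K : HeytingField c ℓ₁ ℓ₂) where
  open HeytingField K using (Carrier; _≈_; _#_; _+_; _*_; 0#; 1#; #⇒invertible; heytingCommutativeRing)
  open HeytingCommutativeRing heytingCommutativeRing using (commutativeRing)
  open import Algebra.Definitions.RawMonoid
    (CommutativeRing.+-rawMonoid commutativeRing)
    using (sum) renaming (_×_ to _·_)

  CharacteristicZero : Set ℓ₂
  CharacteristicZero = ∀ n → (suc n · 1#) # 0#

  module _ {X : Set} where

    infix 4 _≐_
    _≐_ : (f g : X → Carrier) → Set ℓ₁
    f ≐ g = ∀ x → f x ≈ g x

    combination : ∀ {m} → (Fin m → Carrier) → (Fin m → X → Carrier) → X → Carrier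
    combination coeff b x = sum λ i → coeff i * b i x

    Span : ∀ {m} → (Fin m → X → Carrier) → Pred (X → Carrier) (c ⊔ ℓ₁)
    Span b f = ∃[ coeff ] (f ≐ combination coeff b)

    LinearlyIndependent : ∀ {m} → (Fin m → X → Carrier) → Set (c ⊔ ℓ₁)
    LinearlyIndependent b =
      ∀ coeff → combination coeff b ≐ (λ _ → 0#) → ∀ i → coeff i ≈ 0#

    HasDimension : ∀ {ℓ} → Pred (X → Carrier) ℓ → ℕ → Set (c ⊔ ℓ₁ ⊔ ℓ)
    HasDimension V d = Σ (Fin d → X → Carrier) λ b →
      (∀ i → V (b i)) × LinearlyIndependent b × (∀ f → V f → Span b f)

    module _ (char0 : CharacteristicZero) where

      -- #⇒invertible yields an inverse of suc n · 1# - 0#.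
      1/suc : ℕ → Carrier
      1/suc n = proj₁ (#⇒invertible (char0 n))

      average : (X → Carrier) → List⁺ X → Carrier
      average f (x List⁺.∷ xs) =
        1/suc (List.length xs) * List.foldr (λ y s → f y + s) 0# (x List.∷ xs)

  module _ (F : Fence) where

    Statistic : Set c
    Statistic = OrderIdeal F → Carrier

    indicator : ∀ {P : Set} → Dec P → Carrier
    indicator d = if does d then 1# else 0#

    χ̂ : Element F → Statistic
    χ̂ q I = indicator (q ∈? set I)

    χ : Element F → Statistic
    χ q I = indicator (maximal? F (_∈? set I) q)

    module _ (char0 : CharacteristicZero) where

      Homomesic : Pred Statistic (c ⊔ ℓ₁)
      Homomesic f = ∃[ m ] (∀ O → IsOrbit F O → average char0 f O ≈ m)

      I-H : Pred Statistic (c ⊔ ℓ₁)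
      I-H f = Span χ̂ f × Homomesic f

      A-H : Pred Statistic (c ⊔ ℓ₁)
      A-H f = Span χ f × Homomesic f

{-# OPTIONS --safe #-}

-- Every element q of a fence either has at most one upper cover or is minimal.
-- If q is maximal then χ_q = χ̂_q; if r is its only upper cover then
-- χ_q = χ̂_q − χ̂_r; otherwise q is minimal and χ_q(ρ I) = 1 − χ̂_q(I), so that χ_q and
-- −χ̂_q have averages differing by 1 on every orbit.  Hence χ_q may be replaced by
-- some φ_q in the span of the χ̂'s, where φ is a basis of that span (being
-- triangular with respect to ⊑), without changing homomesy of linear
-- combinations.  Both dimensions are therefore the dimension of one space of
-- coefficients.  That space has a basis constructively, because it is the kernel
-- of a finite integer matrix, over which elimination can decide every pivot.

module Submission where

open import Defs
open import Algebra.Apartness.Bundles using (HeytingField; HeytingCommutativeRing)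
open import Algebra.Bundles using (CommutativeRing)
import Algebra.Properties.Ring
import Algebra.Properties.Semiring.Mult
import Algebra.Properties.Semiring.Sum
import Algebra.Solver.Ring.NaturalCoefficients.Default
open import Data.Bool.Base using (true; false; if_then_else_)
open import Data.Empty using (⊥; ⊥-elim)
open import Data.Fin.Base using (Fin; zero; suc; toℕ; punchIn; finToFun; funToFin)
open import Data.Fin.Induction using (po-wellFounded; po-noetherian)
open import Data.Fin.Patterns using (0F; 1F)
open import Data.Fin.Properties
  using (any?; toℕ-injective; punchInᵢ≢i; pigeonhole; finToFun-funToFin) renaming (_≟_ to _≟ᶠ_)
open import Data.Fin.Subset using (_∈_)
open import Data.Fin.Subset.Properties using (_∈?_; ⊆-antisym)
import Data.Integer.Base as ℤ
import Data.Integer.Properties as ℤ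
open import Data.List.Base as List using (List)
import Data.List.Membership.Propositional as ListMem
open import Data.List.Membership.Propositional.Properties
  using (∈-map⁺; ∈-map⁻; ∈-applyUpTo⁺; ∈-applyUpTo⁻; ∈-deduplicate⁺; ∈-deduplicate⁻)
open import Data.List.Membership.Propositional.Properties.WithK using (unique∧set⇒bag)
open import Data.List.NonEmpty as List⁺ using (List⁺)
open import Data.List.Relation.Binary.BagAndSetEquality using (∼bag⇒↭)
open import Data.List.Relation.Binary.Permutation.Propositional as ↭ using (_↭_)
open import Data.List.Relation.Binary.Permutation.Propositional.Properties using (↭-length)
import Data.List.Relation.Unary.Unique.DecPropositional.Properties as Unique
open import Data.List.Relation.Unary.Unique.Propositional using (Unique)
import Data.List.Relation.Unary.Unique.Propositional.Properties as Unique
open import Data.Nat.Base using (ℕ; zero; suc; _<_; _^_; z<s; s<s; s≤s)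
  renaming (_+_ to _+ℕ_; _*_ to _*ℕ_)
open import Data.Nat.GeneralisedArithmetic using (iterate)
import Data.Nat.Properties as ℕ
open import Data.Nat.Properties
  using (≤-refl; suc-injective; m≤n⇒m<n∨m≡n; m≤n⇒∃[o]m+o≡n)
open import Data.Parity.Base using (1ℙ)
open import Data.Product.Base using (∃-syntax; _×_; _,_; proj₁; proj₂)
open import Data.Sum.Base using (_⊎_; inj₁; inj₂)
open import Data.Vec.Functional using (insertAt)
open import Data.Vec.Functional.Properties using (insertAt-lookup; insertAt-punchIn)
open import Function.Base using (_∘_)
open import Function.Bundles using (_⇔_; mk⇔; Equivalence)
open import Induction.WellFounded using (Acc; acc)
open import Level using (Level; 0ℓ)
open import Relation.Binary.Construct.Closure.ReflexiveTransitive using (ε; _◅_; _◅◅_)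
import Relation.Binary.Construct.Closure.ReflexiveTransitive.Properties as Star
open import Relation.Binary.Definitions using (DecidableEquality)
open import Relation.Binary.PropositionalEquality as ≡ using (_≡_; _≢_)
import Relation.Binary.Reasoning.Setoid
open import Relation.Binary.Structures using (IsPartialOrder)
open import Relation.Nullary.Decidable
  using (Dec; yes; no; does; ¬?; map′; _×-dec_; recompute; dec-true; dec-false; decidable-stable)
open import Relation.Nullary.Negation.Core using (¬_; contradiction)
open import Relation.Unary using (Pred; Decidable)

-- For an element with two upper covers `r` and `s`, χ_q involves the product of χ̂_r and χ̂_s and
-- is not linear in the χ̂'s. A linear relation appears only after averaging, when the values of χ_q
-- are shifted one step along the orbit. The minus sign in -χ̂_q lets χ_q and its replacement carry
-- the same coefficient, so the two spaces of homomesic coefficient vectors coincide. The other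
-- obstacle is constructive: equality in a Heyting field need not be decidable, so a subspace cut
-- out by equations need not come with a basis. Homomesy moreover quantifies over all orbits and
-- over an unknown constant. Comparing finitely many orbits with one reference orbit removes both
-- and leaves homogeneous equations. Their coefficients become integers once the orbit sizes are
-- cleared, because indicators take the values 0 and 1, and in characteristic zero every nonzero
-- integer is invertible.

-- The order on a fence, its ideals and rowmotion

module FenceOrder (F : Fence) where
  open ≡ using (refl; sym; trans; cong; subst)

  infix 4 _≺_ _≼_
  _≺_ _≼_ : Element F → Element F → Set
  _≺_ = _⋖_ F
  _≼_ = _⊑_ F

  -- Ascending minus descending steps to the left of a position. Every cover relation raises it,
  -- which rules out cycles.
  height : ℕ → ℤ.ℤ
  height zero    = ℤ.0ℤ
  height (suc j) =
    -- Positions count from 0 and indices from 1: `suc j` is the index of the element at position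
    -- `j`, whose segment gives the direction of the step to the next one.
    if does (segment? F 1ℙ (suc j)) then ℤ.suc (height j) else ℤ.pred (height j)

  height-≺ : ∀ {x y} → x ≺ y → height (toℕ x) ℤ.< height (toℕ y)
  height-≺ {x} {y} (odd e s) = subst (λ j → _ ℤ.< height j) (sym (suc-injective e)) up
    where
    up : height (toℕ x) ℤ.< height (suc (toℕ x))
    up rewrite dec-true (segment? F 1ℙ (suc (toℕ x))) s = ℤ.suc[i]≤j⇒i<j ℤ.≤-refl
  height-≺ {y} {x} (even e s) = subst (λ j → height j ℤ.< _) (sym (suc-injective e)) down
    where
    ¬odd : ¬ Segment F 1ℙ (suc (toℕ x))
    ¬odd s′ with () ← segment-unique F s s′
    down : height (suc (toℕ x)) ℤ.< height (toℕ x)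
    down rewrite dec-false (segment? F 1ℙ (suc (toℕ x))) ¬odd =
      ℤ.suc[i]≤j⇒i<j (ℤ.≤-reflexive (ℤ.suc-pred _))

  ≺-irrefl : ∀ {x} → ¬ x ≺ x
  ≺-irrefl c = ℤ.<-irrefl refl (height-≺ c)

  height-≼ : ∀ {x y} → x ≼ y → height (toℕ x) ℤ.≤ height (toℕ y)
  height-≼ ε       = ℤ.≤-refl
  height-≼ (c ◅ p) = ℤ.≤-trans (ℤ.<⇒≤ (height-≺ c)) (height-≼ p)

  ≼-antisym : ∀ {x y} → x ≼ y → y ≼ x → x ≡ y
  ≼-antisym ε       _ = refl
  ≼-antisym (c ◅ p) q = ⊥-elim (ℤ.<-irrefl refl
    (ℤ.<-≤-trans (height-≺ c) (ℤ.≤-trans (height-≼ p) (height-≼ q))))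

  ≼-isPartialOrder : IsPartialOrder _≡_ _≼_
  ≼-isPartialOrder = record
    { isPreorder = Star.isPreorder _≺_
    ; antisym    = ≼-antisym
    }

  minimal-below : ∀ {P : Pred (Element F) 0ℓ} (P? : Decidable P) {y} → P y →
                  ∃[ x ] (Minimal F P x × x ≼ y)
  minimal-below {P} P? {y} = go y (po-wellFounded ≼-isPartialOrder y)
    where
    go : ∀ y → Acc _ y → P y → ∃[ x ] (Minimal F P x × x ≼ y)
    go y (acc rs) Py with any? (λ z → P? z ×-dec _⊑?_ F z y ×-dec ¬? (z ≟ᶠ y))
    ... | yes (z , Pz , z≼y , z≢y) =
      let (x , x-min , x≼z) = go z (rs (z≼y , z≢y)) Pz in x , x-min , x≼z ◅◅ z≼y
    ... | no none = y , (Py , λ z Pz z≼y →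
      sym (decidable-stable (z ≟ᶠ y) λ z≢y → none (z , Pz , z≼y , z≢y))) , ε

  adjacent : ∀ {x y} → x ≺ y → toℕ y ≡ suc (toℕ x) ⊎ toℕ x ≡ suc (toℕ y)
  adjacent (odd e _)  = inj₁ (suc-injective e)
  adjacent (even e _) = inj₂ (suc-injective e)

  -- The cases overlap: the first element of the fence is minimal and has a single upper cover. The
  -- lemmas below accept any shape of `q`, so the choice made by `shape` is harmless.
  data Shape (q : Element F) : Set where
    maximal : (∀ y → ¬ q ≺ y) → Shape q
    one-up  : ∀ r → q ≺ r → (∀ y → q ≺ y → y ≡ r) → Shape q
    minimal : (∀ y → ¬ y ≺ q) → Shape q

  -- q has at most two neighbours in the Hasse diagram, so if both are above it
  -- then none is below.
  shape : ∀ q → Shape q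
  shape q with any? (λ r → _⋖?_ F q r)
  ... | no none = maximal λ y c → none (y , c)
  ... | yes (r , q≺r) with any? (λ y → _⋖?_ F q y ×-dec ¬? (y ≟ᶠ r))
  ...   | no none = one-up r q≺r λ y c →
            decidable-stable (y ≟ᶠ r) λ y≢r → none (y , c , y≢r)
  ...   | yes (y , q≺y , y≢r) = minimal λ p p≺q →
            no-neighbour-left p≺q (adjacent p≺q) (adjacent q≺r) (adjacent q≺y)
    where
    up-down : ∀ {p r} → p ≺ q → q ≺ r → toℕ p ≢ toℕ r
    up-down p≺q q≺r e with refl ← toℕ-injective e =
      ℤ.<-irrefl refl (ℤ.<-trans (height-≺ p≺q) (height-≺ q≺r))
    no-neighbour-left : ∀ {p} → p ≺ q →
      toℕ q ≡ suc (toℕ p) ⊎ toℕ p ≡ suc (toℕ q) →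
      toℕ r ≡ suc (toℕ q) ⊎ toℕ q ≡ suc (toℕ r) →
      toℕ y ≡ suc (toℕ q) ⊎ toℕ q ≡ suc (toℕ y) → ⊥
    no-neighbour-left c _ (inj₁ e) (inj₁ e′) = y≢r (toℕ-injective (trans e′ (sym e)))
    no-neighbour-left c _ (inj₂ e) (inj₂ e′) =
      y≢r (toℕ-injective (suc-injective (trans (sym e′) e)))
    no-neighbour-left c (inj₁ d) (inj₂ e) _ = up-down c q≺r (suc-injective (trans (sym d) e))
    no-neighbour-left c (inj₁ d) _ (inj₂ e) = up-down c q≺y (suc-injective (trans (sym d) e))
    no-neighbour-left c (inj₂ d) (inj₁ e) _ = up-down c q≺r (trans d (sym e))
    no-neighbour-left c (inj₂ d) _ (inj₁ e) = up-down c q≺y (trans d (sym e))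

  -- downClosed is irrelevant, so it is recovered from decidable membership.
  down-closed : ∀ (I : OrderIdeal F) {x y} → x ≼ y → y ∈ set I → x ∈ set I
  down-closed (ideal S closed) {x} x≼y y∈S = recompute (x ∈? S) (closed x≼y y∈S)

  set-injective : ∀ {I J : OrderIdeal F} → set I ≡ set J → I ≡ J
  set-injective {ideal S _} {ideal .S _} refl = refl

  ideal-ext : ∀ {I J : OrderIdeal F} → (∀ {x} → x ∈ set I → x ∈ set J) →
              (∀ {x} → x ∈ set J → x ∈ set I) → I ≡ J
  ideal-ext I⊆J J⊆I = set-injective (⊆-antisym I⊆J J⊆I)

  Max : OrderIdeal F → Element F → Set
  Max I = Maximal F (_∈ set I)

  Min∁ : OrderIdeal F → Element F → Set
  Min∁ I = Minimal F (λ x → ¬ x ∈ set I)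

  ρ-members : ∀ {I x} → x ∈ set (ρ F I) → ∃[ y ] (Min∁ I y × x ≼ y)
  ρ-members {I} = ∈⟦⟧⁻ F (generatedBy? F (minimal? F (λ x → ¬? (x ∈? set I))))

  ρ-members⁻ : ∀ {I x} → ∃[ y ] (Min∁ I y × x ≼ y) → x ∈ set (ρ F I)
  ρ-members⁻ {I} = ∈⟦⟧⁺ F (generatedBy? F (minimal? F (λ x → ¬? (x ∈? set I))))

  -- A maximal element lies below some generator, which is itself in the ideal, so the two are
  -- equal.
  Max-ρ⇒Min∁ : ∀ {I q} → Max (ρ F I) q → Min∁ I q
  Max-ρ⇒Min∁ {I} {q} (q∈ , top) =
    let (y , y-min , q≼y) = ρ-members {I} q∈
    in  subst (Min∁ I) (sym (top y (ρ-members⁻ {I} (y , y-min , ε)) q≼y)) y-min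

  -- Generators are minimal in one and the same set, so comparable ones coincide. Anything in the
  -- ideal above `q` lies below a generator, which can only be `q`.
  Min∁⇒Max-ρ : ∀ {I q} → Min∁ I q → Max (ρ F I) q
  Min∁⇒Max-ρ {I} {q} q-min = ρ-members⁻ {I} (q , q-min , ε) , λ y y∈ q≼y →
    let (z , z-min , y≼z) = ρ-members {I} y∈
        z≡q = proj₂ z-min q (proj₁ q-min) (q≼y ◅◅ y≼z)
    in  ≼-antisym q≼y (subst (y ≼_) z≡q y≼z)

  -- The maximal elements of `ρ F I` recover the minimal elements of the complement of `I`, and
  -- these determine `I`: a point of `J` outside `I` has one of them below it, which would lie both
  -- in `J` and outside `J`.
  ρ-injective : ∀ {I J} → ρ F I ≡ ρ F J → I ≡ J
  ρ-injective {I} {J} e = ideal-ext {I} {J} (half {J} {I} (sym e)) (half {I} {J} e)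
    where
    half : ∀ {I J} → ρ F I ≡ ρ F J → ∀ {x} → x ∈ set J → x ∈ set I
    half {I} {J} e {x} x∈J = decidable-stable (x ∈? set I) λ x∉I →
      let (m , m-min , m≼x) = minimal-below (λ x → ¬? (x ∈? set I)) x∉I
          m-minJ = Max-ρ⇒Min∁ {J} (subst (λ K → Max K m) e (Min∁⇒Max-ρ {I} m-min))
      in  proj₁ m-minJ (down-closed J m≼x x∈J)

  -- Principal ideals are the test points for linear independence: `q` is the only maximal element
  -- of `↓ q`.
  ↓ : Element F → OrderIdeal F
  ↓ q = ⟨_⟩ F (_≟ᶠ q)

  ↓-members : ∀ {q x} → x ∈ set (↓ q) → x ≼ q
  ↓-members {q} x∈ with (_ , refl , x≼q) ← ∈⟦⟧⁻ F (generatedBy? F (_≟ᶠ q)) x∈ = x≼q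

  ↓-members⁻ : ∀ {q x} → x ≼ q → x ∈ set (↓ q)
  ↓-members⁻ {q} x≼q = ∈⟦⟧⁺ F (generatedBy? F (_≟ᶠ q)) (q , refl , x≼q)

  Max-↓⇒≡ : ∀ {p q} → Max (↓ q) p → p ≡ q
  Max-↓⇒≡ (p∈ , top) = top _ (↓-members⁻ ε) (↓-members p∈)

  Max-↓ : ∀ q → Max (↓ q) q
  Max-↓ q = ↓-members⁻ ε , λ y y∈ q≼y → ≼-antisym q≼y (↓-members y∈)

-- Orbits of an injective map on a finite set

module _ {A : Set} where
  open ≡ using (refl)

  iterate-suc : ∀ (f : A → A) x n → iterate f x (suc n) ≡ f (iterate f x n)
  iterate-suc f x zero    = refl
  iterate-suc f x (suc n) = iterate-suc f (f x) n

  iterate-+ : ∀ (f : A → A) x m n → iterate f x (m +ℕ n) ≡ iterate f (iterate f x m) n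
  iterate-+ f x zero    n = refl
  iterate-+ f x (suc m) n = iterate-+ f (f x) m n

  iterate-injective : ∀ {f : A → A} → (∀ {x y} → f x ≡ f y → x ≡ y) →
                      ∀ n {x y} → iterate f x n ≡ iterate f y n → x ≡ y
  iterate-injective f-inj zero    e = e
  iterate-injective f-inj (suc n) e = f-inj (iterate-injective f-inj n e)

module FiniteOrbits {X : Set} {N : ℕ}
  (encode : X → Fin N) (encode-injective : ∀ {I J} → encode I ≡ encode J → I ≡ J)
  (ρ : X → X) (ρ-injective : ∀ {I J} → ρ I ≡ ρ J → I ≡ J) where
  open ≡ using (refl; sym; trans; cong)

  -- `IsOrbit` with the ideals and rowmotion abstracted; for a fence the two agree by computation.
  IsOrbitOf : List⁺ X → Set
  IsOrbitOf O = Unique (List⁺.toList O) ×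
    ∃[ I ] (∀ J → (J ListMem.∈ List⁺.toList O) ⇔ (∃[ k ] (iterate ρ I k ≡ J)))

  _≟_ : DecidableEquality X
  I ≟ J = map′ (encode-injective) (cong encode) (encode I ≟ᶠ encode J)

  -- Two iterates coincide by the pigeonhole principle, and injectivity cancels their common steps,
  -- so the first return is to `I` itself.
  period : ∀ I → ∃[ n ] iterate ρ I (suc n) ≡ I
  period I =
    let (i , j , i<j , e) = pigeonhole ≤-refl code
        (n , i+n≡j) = m≤n⇒∃[o]m+o≡n i<j
    in  n , iterate-injective ρ-injective (toℕ i) (begin
      iterate ρ (iterate ρ I (suc n)) (toℕ i)  ≡⟨ iterate-+ ρ I (suc n) (toℕ i) ⟨
      iterate ρ I (suc n +ℕ toℕ i)
        ≡⟨ cong (iterate ρ I) (trans (cong suc (ℕ.+-comm n (toℕ i))) i+n≡j) ⟩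
      iterate ρ I (toℕ j)                          ≡⟨ encode-injective e ⟨
      iterate ρ I (toℕ i)                          ∎)
    where
    open ≡.≡-Reasoning
    code : Fin (suc N) → Fin N
    code k = encode (iterate ρ I (toℕ k))

  Reaches : X → X → Set
  Reaches I J = ∃[ k ] iterate ρ I k ≡ J

  -- The deduplicated list of the iterates over one period, unfolded once so that its head `I` is
  -- visible. The proofs below use that it computes to that list.
  orbit : X → List⁺ X
  orbit I = I List⁺.∷ List.filter (¬? ∘ (I ≟_))
    (List.deduplicate _≟_ (List.applyUpTo (iterate ρ (ρ I)) (proj₁ (period I))))

  orbit-members : ∀ I J → (J ListMem.∈ List⁺.toList (orbit I)) ⇔ Reaches I J
  orbit-members I J = mk⇔ to from
    where
    n = proj₁ (period I)
    iterates = List.applyUpTo (iterate ρ I) (suc n)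
    to : J ListMem.∈ List⁺.toList (orbit I) → Reaches I J
    to J∈ with k , _ , e ← ∈-applyUpTo⁻ (iterate ρ I) {n = suc n} (∈-deduplicate⁻ _≟_ iterates J∈) =
      k , sym e
    -- Reduction of `k` modulo `suc n`, one step at a time, wrapping from `n` back to 0.
    reduce : ∀ k → ∃[ j ] (j < suc n × iterate ρ I k ≡ iterate ρ I j)
    reduce zero = 0 , z<s , refl
    reduce (suc k) with j , s≤s j≤n , e ← reduce k = wrap (m≤n⇒m<n∨m≡n j≤n)
      (trans (iterate-suc ρ I k) (trans (cong ρ e) (sym (iterate-suc ρ I j))))
      where
      wrap : ∀ {j K} → j < n ⊎ j ≡ n → K ≡ iterate ρ I (suc j) →
             ∃[ i ] (i < suc n × K ≡ iterate ρ I i)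
      wrap {j} (inj₁ j<n) e = suc j , s<s j<n , e
      wrap (inj₂ refl)    e = 0 , z<s , trans e (proj₂ (period I))
    from : Reaches I J → J ListMem.∈ List⁺.toList (orbit I)
    from (k , refl) with j , j<n , e ← reduce k rewrite e =
      ∈-deduplicate⁺ _≟_ (∈-applyUpTo⁺ (iterate ρ I) j<n)

  orbit-isOrbit : ∀ I → IsOrbitOf (orbit I)
  orbit-isOrbit I =
    Unique.deduplicate-! _≟_ (List.applyUpTo (iterate ρ I) (suc (proj₁ (period I)))) ,
    I , orbit-members I

  -- An orbit may be listed in any order, but duplicate-free lists with the same members are
  -- permutations of each other. Up to permutation every orbit is thus one of the computed ones.
  isOrbit-↭ : ∀ O (O-orbit : IsOrbitOf O) →
    List⁺.toList O ↭ List⁺.toList (orbit (proj₁ (proj₂ O-orbit)))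
  isOrbit-↭ O (unique , I , members) = ∼bag⇒↭ (unique∧set⇒bag unique (proj₁ (orbit-isOrbit I))
    λ {J} → mk⇔
      (Equivalence.from (orbit-members I J) ∘ Equivalence.to (members J))
      (Equivalence.from (members J) ∘ Equivalence.to (orbit-members I J)))

  ρ-permutes-orbit : ∀ O → IsOrbitOf O → List.map ρ (List⁺.toList O) ↭ List⁺.toList O
  ρ-permutes-orbit O (unique , I , members) =
    ∼bag⇒↭ (unique∧set⇒bag (Unique.map⁺ ρ-injective unique) unique λ {J} → mk⇔ (to J) (from J))
    where
    to : ∀ J → J ListMem.∈ List.map ρ (List⁺.toList O) → J ListMem.∈ List⁺.toList O
    to J J∈ with H , H∈ , refl ← ∈-map⁻ ρ J∈ with k , refl ← Equivalence.to (members H) H∈ =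
      Equivalence.from (members J) (suc k , iterate-suc ρ I k)
    image : ∀ k {J} → iterate ρ I (suc k) ≡ J → J ListMem.∈ List.map ρ (List⁺.toList O)
    image k refl rewrite iterate-suc ρ I k = ∈-map⁺ ρ (Equivalence.from (members _) (k , refl))
    from : ∀ J → J ListMem.∈ List⁺.toList O → J ListMem.∈ List.map ρ (List⁺.toList O)
    from J J∈ with Equivalence.to (members J) J∈
    ... | suc k , e    = image k e
    -- The starting point is the image of the last iterate of its period.
    ... | zero  , refl = image (proj₁ (period I)) (proj₂ (period I))

-- Finiteness of the set of ideals

module FenceOrbits (F : Fence) where
  open FenceOrder F
  open ≡ using (sym; trans; cong)

  Ideal : Set
  Ideal = OrderIdeal F

  encode : Ideal → Fin (2 ^ size F)
  encode I = funToFin λ x → if does (x ∈? set I) then 1F else 0F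

  -- Generating an ideal makes every bit vector a valid code, and leaves one that is already
  -- down-closed unchanged. Hence the codes also enumerate all orbits.
  decode : Fin (2 ^ size F) → Ideal
  decode k = ⟨_⟩ F λ x → finToFun k x ≟ᶠ 1F

  decode-encode : ∀ I → decode (encode I) ≡ I
  decode-encode I = ideal-ext {decode (encode I)} {I} to from
    where
    member? : Element F → Fin 2
    member? x = if does (x ∈? set I) then 1F else 0F
    to : ∀ {x} → x ∈ set (decode (encode I)) → x ∈ set I
    to x∈ with y , e , x≼y ← ∈⟦⟧⁻ F (generatedBy? F λ x → finToFun (encode I) x ≟ᶠ 1F) x∈
      with y ∈? set I | trans (sym (finToFun-funToFin member? y)) e
    ... | yes y∈ | _  = down-closed I x≼y y∈
    ... | no _   | ()
    from : ∀ {x} → x ∈ set I → x ∈ set (decode (encode I))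
    from {x} x∈ = ∈⟦⟧⁺ F (generatedBy? F λ x → finToFun (encode I) x ≟ᶠ 1F)
      (x , trans (finToFun-funToFin member? x)
             (cong (if_then 1F else 0F) (dec-true (x ∈? set I) x∈)) , ε)

  encode-injective : ∀ {I J} → encode I ≡ encode J → I ≡ J
  encode-injective {I} {J} e = trans (sym (decode-encode I)) (trans (cong decode e) (decode-encode J))

  open FiniteOrbits {Ideal} encode (λ {I} {J} → encode-injective {I} {J})
    (ρ F) (λ {I} {J} → ρ-injective {I} {J}) public

-- Linear algebra over a Heyting field

module LinearAlgebra {c ℓ₁ ℓ₂ : Level} (K : HeytingField c ℓ₁ ℓ₂) where
  open HeytingField K using (#⇒invertible; heytingCommutativeRing)

  R : CommutativeRing c ℓ₁
  R = HeytingCommutativeRing.commutativeRing heytingCommutativeRing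

  open CommutativeRing R public hiding (zero)
  open import Algebra.Definitions.RawMonoid +-rawMonoid public using (sum) renaming (_×_ to _·_)
  open Algebra.Properties.Ring ring public
    using (-0#≈0#; -1*x≈-x; x∙y⁻¹≈ε⇒x≈y; x≈y⇒x∙y⁻¹≈ε; -‿distribˡ-*; -‿distribʳ-*;
           -‿involutive; +-cancelˡ; +-cancelʳ; +-inverseˡ-unique)
  open Algebra.Properties.Semiring.Sum semiring public
    using (sum-cong-≋; ∑-distrib-+; ∑-comm; sum-remove; *-distribˡ-sum; *-distribʳ-sum; sum-replicate-zero)
  open Algebra.Properties.Semiring.Mult semiring public using (×-homo-+; ×1-homo-*)
  open Relation.Binary.Reasoning.Setoid setoid public
  open Algebra.Solver.Ring.NaturalCoefficients.Default commutativeSemiring public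
    using (solve; _:+_; _:*_; _:=_)

  private variable
    m n d : ℕ
    X : Set

  dot : (Fin n → Carrier) → (Fin n → Carrier) → Carrier
  dot w v = sum λ i → w i * v i

  sum-zero : ∀ {f : Fin n → Carrier} → (∀ i → f i ≈ 0#) → sum f ≈ 0#
  sum-zero {n} f≈0 = trans (sum-cong-≋ f≈0) (sum-replicate-zero n)

  sum-single : ∀ {f : Fin n → Carrier} j → (∀ i → i ≢ j → f i ≈ 0#) → sum f ≈ f j
  sum-single {suc n} {f} j f≈0 = begin
    sum f                         ≈⟨ sum-remove {i = j} f ⟩
    f j + sum (f ∘ punchIn j)     ≈⟨ +-congˡ (sum-zero λ i → f≈0 (punchIn j i) (punchInᵢ≢i j i)) ⟩
    f j + 0#                      ≈⟨ +-identityʳ (f j) ⟩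
    f j                           ∎

  *-distrib-sum-assoc : ∀ x (f g : Fin n → Carrier) →
    x * dot f g ≈ sum λ i → (x * f i) * g i
  *-distrib-sum-assoc x f g =
    trans (*-distribˡ-sum x λ i → f i * g i) (sum-cong-≋ λ i → sym (*-assoc x (f i) (g i)))

  combination-assoc : ∀ (a : Fin m → Carrier) (v : Fin m → Fin n → Carrier) (w : Fin n → Carrier) →
    dot (combination K a v) w ≈ sum λ i → a i * dot (v i) w
  combination-assoc a v w = begin
    (sum λ j → (sum λ i → a i * v i j) * w j)  ≈⟨ sum-cong-≋ (λ j → *-distribʳ-sum (w j) λ i → a i * v i j) ⟩
    (sum λ j → sum λ i → a i * v i j * w j)    ≈⟨ ∑-comm (λ j i → a i * v i j * w j) ⟩
    (sum λ i → sum λ j → a i * v i j * w j)    ≈⟨ sum-cong-≋ (λ i → *-distrib-sum-assoc (a i) (v i) w) ⟨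
    (sum λ i → a i * dot (v i) w)              ∎

  dot-comm : ∀ (v w : Fin n → Carrier) → dot v w ≈ dot w v
  dot-comm v w = sum-cong-≋ λ i → *-comm (v i) (w i)

  dot-combination : ∀ (w : Fin n → Carrier) (a : Fin m → Carrier) (v : Fin m → Fin n → Carrier) →
    dot w (combination K a v) ≈ sum λ i → a i * dot w (v i)
  dot-combination w a v = begin
    dot w (combination K a v)      ≈⟨ dot-comm w _ ⟩
    dot (combination K a v) w      ≈⟨ combination-assoc a v w ⟩
    (sum λ i → a i * dot (v i) w)  ≈⟨ sum-cong-≋ (λ i → *-congˡ (dot-comm (v i) w)) ⟩
    (sum λ i → a i * dot w (v i))  ∎

  dot-linear : ∀ (w : Fin n → Carrier) s u t v →
    dot w (λ i → s * u i + t * v i) ≈ s * dot w u + t * dot w v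
  dot-linear w s u t v = begin
    (sum λ i → w i * (s * u i + t * v i))
      ≈⟨ sum-cong-≋ (λ i → solve 5 (λ w s u t v →
           w :* (s :* u :+ t :* v) := s :* (w :* u) :+ t :* (w :* v))
           refl (w i) s (u i) t (v i)) ⟩
    (sum λ i → s * (w i * u i) + t * (w i * v i))
      ≈⟨ ∑-distrib-+ (λ i → s * (w i * u i)) (λ i → t * (w i * v i)) ⟩
    (sum λ i → s * (w i * u i)) + (sum λ i → t * (w i * v i))
      ≈⟨ +-cong (*-distribˡ-sum s λ i → w i * u i) (*-distribˡ-sum t λ i → w i * v i) ⟨
    s * dot w u + t * dot w v ∎

  Invertible : Carrier → Set _
  Invertible x = ∃[ y ] y * x ≈ 1#

  cancel-unit : ∀ {x y} → Invertible x → y * x ≈ 0# → y ≈ 0#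
  cancel-unit {x} {y} (z , zx≈1) yx≈0 = begin
    y             ≈⟨ *-identityʳ y ⟨
    y * 1#        ≈⟨ *-congˡ zx≈1 ⟨
    y * (z * x)   ≈⟨ solve 3 (λ y z x → y :* (z :* x) := z :* (y :* x)) refl y z x ⟩
    z * (y * x)   ≈⟨ *-congˡ yx≈0 ⟩
    z * 0#        ≈⟨ zeroʳ z ⟩
    0#            ∎

  -- x = m − n in K, with n moved over so that sums and products are semiring identities.
  Integral : Pred Carrier ℓ₁
  Integral x = ∃[ m ] ∃[ n ] x + n · 1# ≈ m · 1#

  integral-0 : Integral 0#
  integral-0 = 0 , 0 , +-identityˡ 0#

  integral-1 : Integral 1#
  integral-1 = 1 , 0 , refl

  integral-+ : ∀ {x y} → Integral x → Integral y → Integral (x + y)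
  integral-+ {x} {y} (m , n , e) (m′ , n′ , e′) = m +ℕ m′ , n +ℕ n′ , (begin
    (x + y) + (n +ℕ n′) · 1#         ≈⟨ +-congˡ (×-homo-+ 1# n n′) ⟩
    (x + y) + (n · 1# + n′ · 1#)     ≈⟨ solve 4 (λ x y n n′ →
                                          (x :+ y) :+ (n :+ n′) := (x :+ n) :+ (y :+ n′))
                                          refl x y (n · 1#) (n′ · 1#) ⟩
    (x + n · 1#) + (y + n′ · 1#)     ≈⟨ +-cong e e′ ⟩
    m · 1# + m′ · 1#                 ≈⟨ ×-homo-+ 1# m m′ ⟨
    (m +ℕ m′) · 1#                   ∎)

  integral-* : ∀ {x y} → Integral x → Integral y → Integral (x * y)
  integral-* {x} {y} (m , n , e) (m′ , n′ , e′) =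
    -- From (m - n)(m′ - n′) = (mm′ + nn′) - (mn′ + nm′).
    m *ℕ m′ +ℕ n *ℕ n′ , m *ℕ n′ +ℕ n *ℕ m′ , (begin
    x * y + (m *ℕ n′ +ℕ n *ℕ m′) · 1#          ≈⟨ +-congˡ (hom m n′ n m′) ⟩
    x * y + (m · 1# * N′ + N * (m′ · 1#))      ≈⟨ +-congˡ (+-cong (*-congʳ e) (*-congˡ e′)) ⟨
    x * y + ((x + N) * N′ + N * (y + N′))      ≈⟨ solve 4 (λ x y n n′ →
                                                     x :* y :+ ((x :+ n) :* n′ :+ n :* (y :+ n′)) :=
                                                     (x :+ n) :* (y :+ n′) :+ n :* n′)
                                                    refl x y N N′ ⟩
    (x + N) * (y + N′) + N * N′                ≈⟨ +-congʳ (*-cong e e′) ⟩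
    m · 1# * (m′ · 1#) + N * N′                ≈⟨ hom m m′ n n′ ⟨
    (m *ℕ m′ +ℕ n *ℕ n′) · 1#                  ∎)
    where
    N = n · 1#
    N′ = n′ · 1#
    hom : ∀ i j k l → (i *ℕ j +ℕ k *ℕ l) · 1# ≈ i · 1# * (j · 1#) + k · 1# * (l · 1#)
    hom i j k l = trans (×-homo-+ 1# (i *ℕ j) (k *ℕ l)) (+-cong (×1-homo-* i j) (×1-homo-* k l))

  integral-neg : ∀ {x} → Integral x → Integral (- x)
  integral-neg {x} (m , n , e) = n , m , (begin
    - x + m · 1#          ≈⟨ +-congˡ e ⟨
    - x + (x + n · 1#)    ≈⟨ +-assoc _ _ _ ⟨
    (- x + x) + n · 1#    ≈⟨ +-congʳ (-‿inverseˡ x) ⟩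
    0# + n · 1#           ≈⟨ +-identityˡ _ ⟩
    n · 1#                ∎)

  integral-sum : ∀ {f : Fin n → Carrier} → (∀ i → Integral (f i)) → Integral (sum f)
  integral-sum {zero}  _ = integral-0
  integral-sum {suc n} h = integral-+ (h zero) (integral-sum (h ∘ suc))

  standard : Fin n → Fin n → Carrier
  standard i j = if does (i ≟ᶠ j) then 1# else 0#

  standard-off : ∀ {i j : Fin n} → i ≢ j → standard i j ≈ 0#
  standard-off {i = i} {j} i≢j rewrite dec-false (i ≟ᶠ j) i≢j = refl

  standard-diagonal : ∀ (i : Fin n) → standard i i ≈ 1#
  standard-diagonal i rewrite dec-true (i ≟ᶠ i) ≡.refl = refl

  standard-combination : ∀ (a : Fin n → Carrier) j → combination K a standard j ≈ a j
  standard-combination a j = trans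
    (sum-single j λ i i≢j → trans (*-congˡ (standard-off i≢j)) (zeroʳ (a i)))
    (trans (*-congˡ (standard-diagonal j)) (*-identityʳ _))

  Kernel : (Fin m → Fin n → Carrier) → Pred (Fin n → Carrier) ℓ₁
  Kernel w v = ∀ i → dot (w i) v ≈ 0#

  -- Integral entries are the induction invariant: they make the values of the next equation on the
  -- basis integral, so that a pivot can be looked for.
  IntegralBasis : ∀ {ℓ} → Pred (Fin n → Carrier) ℓ → ℕ → Set _
  IntegralBasis {n = n} V d = ∃[ b ]
    (∀ (i : Fin d) (j : Fin n) → Integral (b i j)) ×
    (∀ i → V (b i)) × LinearlyIndependent K b × (∀ f → V f → Span K b f)

  -- Elimination with decidable pivots

  module _ (char0 : CharacteristicZero K) where

    1/suc-inverse : ∀ n → 1/suc K {X} char0 n * (suc n · 1#) ≈ 1#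
    1/suc-inverse n = trans
      (*-congˡ (sym (trans (+-congˡ -0#≈0#) (+-identityʳ _))))
      (proj₁ (proj₂ (#⇒invertible (char0 n))))

    suc-invertible : ∀ n → Invertible (suc n · 1#)
    suc-invertible n = _ , 1/suc-inverse {ℕ} n

    -- Ones are cancelled from both parts of the difference until one part is 0. What remains is 0
    -- or, up to sign, a positive multiple of `1#`, which characteristic zero makes invertible.
    integral-zero-or-unit : ∀ {x} → Integral x → x ≈ 0# ⊎ Invertible x
    integral-zero-or-unit (m , n , e) = go m n e
      where
      go : ∀ m n {x} → x + n · 1# ≈ m · 1# → x ≈ 0# ⊎ Invertible x
      go zero zero {x} e = inj₁ (trans (sym (+-identityʳ x)) e)
      go (suc m) zero {x} e =
        let (y , inv) = suc-invertible m
        in  inj₂ (y , trans (*-congˡ (trans (sym (+-identityʳ x)) e)) inv)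
      go zero (suc n) {x} e =
        let (y , inv) = suc-invertible n
        in  inj₂ (- y , (begin
          - y * x                  ≈⟨ *-congˡ (+-inverseˡ-unique x _ e) ⟩
          - y * - (suc n · 1#)     ≈⟨ -‿distribˡ-* y _ ⟨
          - (y * - (suc n · 1#))   ≈⟨ -‿cong (-‿distribʳ-* y _) ⟨
          - - (y * (suc n · 1#))   ≈⟨ -‿involutive _ ⟩
          y * (suc n · 1#)         ≈⟨ inv ⟩
          1#                       ∎))
      go (suc m) (suc n) {x} e = go m n
        (+-cancelˡ 1# _ _ (begin
          1# + (x + n · 1#)  ≈⟨ solve 3 (λ u x n → u :+ (x :+ n) := x :+ (u :+ n)) refl 1# x (n · 1#) ⟩
          x + (1# + n · 1#)  ≈⟨ e ⟩
          1# + m · 1#        ∎))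

    all-zero-or-pivot : ∀ (f : Fin n → Carrier) → (∀ i → Integral (f i)) →
      (∀ i → f i ≈ 0#) ⊎ ∃[ i ] Invertible (f i)
    all-zero-or-pivot {zero}  f _ = inj₁ λ ()
    all-zero-or-pivot {suc n} f h with integral-zero-or-unit (h zero)
    ... | inj₂ u = inj₂ (zero , u)
    ... | inj₁ z with all-zero-or-pivot (f ∘ suc) (h ∘ suc)
    ...   | inj₁ zs      = inj₁ λ { zero → z ; (suc i) → zs i }
    ...   | inj₂ (i , u) = inj₂ (suc i , u)

    -- One elimination step: intersecting the span of `b` with the hyperplane of row zero. Multiples
    -- of the pivot vector `b p` correct the other vectors into the hyperplane, and `b p` is
    -- dropped.
    module Cut {m n d : ℕ} (w : Fin (suc m) → Fin n → Carrier)
      (b : Fin (suc d) → Fin n → Carrier) (p : Fin (suc d)) where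

      ℓ : Fin (suc d) → Carrier
      ℓ i = dot (w zero) (b i)

      -- Scaling by the pivot value ℓ p keeps the new vectors integral.
      b′ : Fin d → Fin n → Carrier
      b′ j x = ℓ p * b (punchIn p j) x + - ℓ (punchIn p j) * b p x

      -- A combination of the `b′` rewritten in terms of `b`: the corrections all collect at the
      -- pivot.
      coefficients : (Fin d → Carrier) → Fin (suc d) → Carrier
      coefficients a = insertAt (λ j → a j * ℓ p) p (sum λ j → a j * - ℓ (punchIn p j))

      combination-b′ : ∀ a x → combination K a b′ x ≈ combination K (coefficients a) b x
      combination-b′ a x = begin
        (sum λ j → a j * (ℓ p * v j + - ℓ (punchIn p j) * b p x))
          ≈⟨ sum-cong-≋ (λ j → solve 5 (λ a l v k y →
               a :* (l :* v :+ k :* y) := a :* k :* y :+ a :* l :* v)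
               refl (a j) (ℓ p) (v j) (- ℓ (punchIn p j)) (b p x)) ⟩
        (sum λ j → a j * - ℓ (punchIn p j) * b p x + a j * ℓ p * v j)
          ≈⟨ ∑-distrib-+ (λ j → a j * - ℓ (punchIn p j) * b p x) (λ j → a j * ℓ p * v j) ⟩
        (sum λ j → a j * - ℓ (punchIn p j) * b p x) + (sum λ j → a j * ℓ p * v j)
          ≈⟨ +-congʳ (*-distribʳ-sum (b p x) λ j → a j * - ℓ (punchIn p j)) ⟨
        (sum λ j → a j * - ℓ (punchIn p j)) * b p x + (sum λ j → a j * ℓ p * v j)
          ≈⟨ +-cong
               (*-congʳ (reflexive (insertAt-lookup _ p _)))
               (sum-cong-≋ λ j → *-congʳ (reflexive (insertAt-punchIn _ p _ j))) ⟨
        C p * b p x + (sum λ j → C (punchIn p j) * v j)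
          ≈⟨ sum-remove {i = p} (λ i → C i * b i x) ⟨
        combination K C b x ∎
        where
        v : Fin d → Carrier
        v j = b (punchIn p j) x
        C : Fin (suc d) → Carrier
        C = coefficients a

      b′-kernel : (∀ i → Kernel (w ∘ suc) (b i)) → ∀ j → Kernel w (b′ j)
      b′-kernel b∈ j k = trans (dot-linear (w k) (ℓ p) (b q) (- ℓ q) (b p)) (vanish k)
        where
        q : Fin (suc d)
        q = punchIn p j
        vanish : ∀ k → ℓ p * dot (w k) (b q) + - ℓ q * dot (w k) (b p) ≈ 0#
        vanish zero = begin
          ℓ p * ℓ q + - ℓ q * ℓ p     ≈⟨ +-cong (*-comm (ℓ p) (ℓ q)) (sym (-‿distribˡ-* (ℓ q) (ℓ p))) ⟩
          ℓ q * ℓ p - ℓ q * ℓ p       ≈⟨ -‿inverseʳ _ ⟩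
          0#                          ∎
        vanish (suc k) = begin
          ℓ p * dot (w (suc k)) (b q) + - ℓ q * dot (w (suc k)) (b p)
            ≈⟨ +-cong (*-congˡ (b∈ q k)) (*-congˡ (b∈ p k)) ⟩
          ℓ p * 0# + - ℓ q * 0#       ≈⟨ +-cong (zeroʳ _) (zeroʳ _) ⟩
          0# + 0#                     ≈⟨ +-identityˡ 0# ⟩
          0#                          ∎

      -- Away from the pivot the coefficients with respect to `b` are `a j * ℓ p`, and `ℓ p`
      -- cancels.
      b′-independent : Invertible (ℓ p) → LinearlyIndependent K b → LinearlyIndependent K b′
      b′-independent u b-indep a a-zero j = cancel-unit u (trans
        (sym (reflexive (insertAt-punchIn _ p _ j)))
        (b-indep (coefficients a) (λ x → trans (sym (combination-b′ a x)) (a-zero x)) (punchIn p j)))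

      -- Dividing by `ℓ p` matches the coefficients away from the pivot. The one at the pivot then
      -- matches because `f` satisfies the equation of row zero.
      b′-spans : Invertible (ℓ p) → ∀ f → Span K b f → dot (w zero) f ≈ 0# → Span K b′ f
      b′-spans (y , yℓ≈1) f (a , f≐) f∈ = a′ , λ x → begin
        f x                            ≈⟨ f≐ x ⟩
        (sum λ i → a i * b i x)        ≈⟨ sum-remove {i = p} (λ i → a i * b i x) ⟩
        a p * b p x + (sum λ j → a (punchIn p j) * b (punchIn p j) x)
          ≈⟨ +-cong (*-congʳ pivot) (sum-cong-≋ λ j → *-congʳ (other j)) ⟨
        C p * b p x + (sum λ j → C (punchIn p j) * b (punchIn p j) x)
          ≈⟨ sum-remove {i = p} (λ i → C i * b i x) ⟨
        combination K C b x            ≈⟨ combination-b′ a′ x ⟨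
        combination K a′ b′ x          ∎
        where
        a′ : Fin d → Carrier
        a′ j = y * a (punchIn p j)
        C : Fin (suc d) → Carrier
        C = coefficients a′
        S T : Carrier
        S = sum λ j → a (punchIn p j) * - ℓ (punchIn p j)
        T = sum λ j → a (punchIn p j) * ℓ (punchIn p j)
        -- Both sides become 0 when `T` is added: the left termwise, the right because it is then
        -- row zero applied to `f`.
        S≈aℓ : S ≈ a p * ℓ p
        S≈aℓ = +-cancelʳ T _ _ (begin
          S + T
            ≈⟨ ∑-distrib-+ (λ j → a (punchIn p j) * - ℓ (punchIn p j))
                           (λ j → a (punchIn p j) * ℓ (punchIn p j)) ⟨
          (sum λ j → a (punchIn p j) * - ℓ (punchIn p j) + a (punchIn p j) * ℓ (punchIn p j))
            ≈⟨ sum-zero {d} (λ j → trans (sym (distribˡ (a (punchIn p j)) _ _))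
                 (trans (*-congˡ (-‿inverseˡ (ℓ (punchIn p j)))) (zeroʳ _))) ⟩
          0#                                ≈⟨ f∈ ⟨
          dot (w zero) f                    ≈⟨ sum-cong-≋ (λ x → *-congˡ (f≐ x)) ⟩
          dot (w zero) (combination K a b)  ≈⟨ dot-combination (w zero) a b ⟩
          (sum λ i → a i * ℓ i)             ≈⟨ sum-remove {i = p} (λ i → a i * ℓ i) ⟩
          a p * ℓ p + T                     ∎)
        other : ∀ j → C (punchIn p j) ≈ a (punchIn p j)
        other j = begin
          C (punchIn p j)                ≈⟨ reflexive (insertAt-punchIn _ p _ j) ⟩
          y * a (punchIn p j) * ℓ p      ≈⟨ solve 3 (λ y a l → y :* a :* l := a :* (y :* l))
                                              refl y (a (punchIn p j)) (ℓ p) ⟩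
          a (punchIn p j) * (y * ℓ p)    ≈⟨ *-congˡ yℓ≈1 ⟩
          a (punchIn p j) * 1#           ≈⟨ *-identityʳ _ ⟩
          a (punchIn p j)                ∎
        pivot : C p ≈ a p
        pivot = begin
          C p                            ≈⟨ reflexive (insertAt-lookup _ p _) ⟩
          (sum λ j → y * a (punchIn p j) * - ℓ (punchIn p j))
                                         ≈⟨ *-distrib-sum-assoc y (a ∘ punchIn p) (λ j → - ℓ (punchIn p j)) ⟨
          y * S                          ≈⟨ *-congˡ S≈aℓ ⟩
          y * (a p * ℓ p)                ≈⟨ solve 3 (λ y a l → y :* (a :* l) := a :* (y :* l))
                                              refl y (a p) (ℓ p) ⟩
          a p * (y * ℓ p)                ≈⟨ *-congˡ yℓ≈1 ⟩
          a p * 1#                       ≈⟨ *-identityʳ _ ⟩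
          a p                            ∎

    -- Induction on the rows, starting from the standard basis. A new row either vanishes on the
    -- current basis, and so on its span, or has a pivot there and lowers the dimension by one.
    kernel-basis : ∀ (w : Fin m → Fin n → Carrier) → (∀ i j → Integral (w i j)) →
      ∃[ d ] IntegralBasis (Kernel w) d
    kernel-basis {zero} {n} w _ = n , standard , integral , (λ _ ()) , independent , spans
      where
      integral : ∀ i j → Integral (standard i j)
      integral i j with does (i ≟ᶠ j)
      ... | true  = integral-1
      ... | false = integral-0
      independent : LinearlyIndependent K standard
      independent a a-zero i = trans (sym (standard-combination a i)) (a-zero i)
      spans : ∀ f → Kernel w f → Span K standard f
      spans f _ = f , λ j → sym (standard-combination f j)
    kernel-basis {suc m} w w-int with kernel-basis (w ∘ suc) (w-int ∘ suc)
    ... | d , b , b-int , b∈ , b-indep , b-spans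
      with all-zero-or-pivot (λ i → dot (w zero) (b i))
             (λ i → integral-sum λ j → integral-* (w-int zero j) (b-int i j))
    ...   | inj₁ zs = d , b , b-int , (λ { i zero → zs i ; i (suc k) → b∈ i k }) ,
                      b-indep , λ f f∈ → b-spans f (f∈ ∘ suc)
    -- The pivot index `p` forces the dimension to be a successor.
    kernel-basis {suc m} w w-int | suc d , b , b-int , b∈ , b-indep , b-spans | inj₂ (p , u) =
      d , b′ , b′-int , b′-kernel b∈ , b′-independent u b-indep ,
      λ f f∈ → b′-spans u f (b-spans f (f∈ ∘ suc)) (f∈ zero)
      where
      open Cut w b p
      ℓ-int : ∀ i → Integral (ℓ i)
      ℓ-int i = integral-sum λ j → integral-* (w-int zero j) (b-int i j)
      b′-int : ∀ i j → Integral (b′ i j)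
      b′-int i j = integral-+ (integral-* (ℓ-int p) (b-int (punchIn p i) j))
        (integral-* (integral-neg (ℓ-int (punchIn p i))) (b-int p j))

  HasDimension-resp : ∀ {ℓ ℓ′} {P : Pred (X → Carrier) ℓ} {Q : Pred (X → Carrier) ℓ′} →
    (∀ f → P f → Q f) → (∀ f → Q f → P f) → HasDimension K P d → HasDimension K Q d
  HasDimension-resp P⇒Q Q⇒P (b , b∈ , indep , spans) =
    b , (λ i → P⇒Q _ (b∈ i)) , indep , λ f Qf → spans f (Q⇒P f Qf)

  -- Independence of `e` makes a coefficient vector determined by its combination, so bases can be
  -- carried over from coefficients to functions. `H` has to respect pointwise equality because
  -- `Span` gives no more.
  HasDimension-Span : ∀ {ℓ} {e : Fin n → X → Carrier} {H : Pred (X → Carrier) ℓ} →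
    LinearlyIndependent K e → (∀ {f g} → _≐_ K f g → H f → H g) →
    HasDimension K (λ a → H (combination K a e)) d →
    HasDimension K (λ f → Span K e f × H f) d
  HasDimension-Span {e = e} {H} e-indep H-resp (b , b∈ , b-indep , b-spans) =
    b′ , (λ i → (b i , λ _ → refl) , b∈ i) , independent , spans
    where
    b′ = λ i → combination K (b i) e
    assoc : ∀ a x → combination K (combination K a b) e x ≈ combination K a b′ x
    assoc a x = combination-assoc a b λ i → e i x
    independent : LinearlyIndependent K b′
    independent a a-zero =
      b-indep a (e-indep _ λ x → trans (assoc a x) (a-zero x))
    spans : ∀ f → Span K e f × H f → Span K b′ f
    spans f ((a , f≐) , Hf) with b-spans a (H-resp f≐ Hf)
    ... | c , a≐ = c , λ x → trans (f≐ x)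
      (trans (sum-cong-≋ λ i → *-congʳ (a≐ i)) (assoc c x))

  Span-element : ∀ (e : Fin n → X → Carrier) i → Span K e (e i)
  Span-element e i = standard i , λ x → sym (trans
    (sum-single i λ j j≢i → trans (*-congʳ (standard-off (j≢i ∘ ≡.sym))) (zeroˡ _))
    (trans (*-congʳ (standard-diagonal i)) (*-identityˡ _)))

  Span-resp : ∀ {e : Fin n → X → Carrier} {f g} → _≐_ K f g → Span K e f → Span K e g
  Span-resp f≐g (a , f≐) = a , λ x → trans (sym (f≐g x)) (f≐ x)

  Span-+ : ∀ {e : Fin n → X → Carrier} {f g} →
    Span K e f → Span K e g → Span K e (λ x → f x + g x)
  Span-+ {e = e} (a , f≐) (b , g≐) = (λ i → a i + b i) , λ x → trans (+-cong (f≐ x) (g≐ x))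
    (trans (sym (∑-distrib-+ (λ i → a i * e i x) (λ i → b i * e i x)))
      (sum-cong-≋ λ i → sym (distribʳ (e i x) (a i) (b i))))

  Span-* : ∀ {e : Fin n → X → Carrier} {f} s → Span K e f → Span K e (λ x → s * f x)
  Span-* {e = e} s (a , f≐) = (λ i → s * a i) , λ x →
    trans (*-congˡ (f≐ x)) (*-distrib-sum-assoc s a (λ i → e i x))

  Span-neg : ∀ {e : Fin n → X → Carrier} {f} → Span K e f → Span K e (λ x → - f x)
  Span-neg {f = f} f∈ = Span-resp (λ x → -1*x≈-x (f x)) (Span-* (- 1#) f∈)

  Span-trans : ∀ {e : Fin m → X → Carrier} {b : Fin n → X → Carrier} {f} →
    (∀ i → Span K b (e i)) → Span K e f → Span K b f
  Span-trans {b = b} e∈ (a , f≐) = combination K a (λ i → proj₁ (e∈ i)) , λ x → trans (f≐ x)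
    (trans (sum-cong-≋ λ i → *-congˡ (proj₂ (e∈ i) x))
      (sym (combination-assoc a (λ i → proj₁ (e∈ i)) (λ i → b i x))))

-- Averages over lists and equations between them

module Averages {c ℓ₁ ℓ₂ : Level} (K : HeytingField c ℓ₁ ℓ₂) (char0 : CharacteristicZero K) where
  open LinearAlgebra K

  private variable
    n : ℕ
    X : Set

  total : (X → Carrier) → List X → Carrier
  total f = List.foldr (λ y s → f y + s) 0#

  size# : List⁺ X → Carrier
  size# O = List⁺.length O · 1#

  mean : (X → Carrier) → List⁺ X → Carrier
  mean = average K char0

  total-cong : ∀ {f g : X → Carrier} → (∀ x → f x ≈ g x) → ∀ xs → total f xs ≈ total g xs
  total-cong f≈g List.[]       = refl
  total-cong f≈g (x List.∷ xs) = +-cong (f≈g x) (total-cong f≈g xs)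

  total-↭ : ∀ (f : X → Carrier) {xs ys} → xs ↭ ys → total f xs ≈ total f ys
  total-↭ f ↭.refl          = refl
  total-↭ f (↭.prep x p)    = +-congˡ (total-↭ f p)
  total-↭ f {_ List.∷ _ List.∷ xs} {_ List.∷ _ List.∷ ys} (↭.swap x y p) = begin
    f x + (f y + total f xs)  ≈⟨ solve 3 (λ x y s → x :+ (y :+ s) := y :+ (x :+ s))
                                   refl (f x) (f y) (total f xs) ⟩
    f y + (f x + total f xs)  ≈⟨ +-congˡ (+-congˡ (total-↭ f p)) ⟩
    f y + (f x + total f ys)  ∎
  total-↭ f (↭.trans p q)   = trans (total-↭ f p) (total-↭ f q)

  total-map : ∀ (f : X → Carrier) (g : X → X) xs → total f (List.map g xs) ≈ total (f ∘ g) xs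
  total-map f g List.[]       = refl
  total-map f g (x List.∷ xs) = +-congˡ (total-map f g xs)

  total-+ : ∀ (f g : X → Carrier) xs → total (λ x → f x + g x) xs ≈ total f xs + total g xs
  total-+ f g List.[]       = sym (+-identityˡ 0#)
  total-+ f g (x List.∷ xs) = trans (+-congˡ (total-+ f g xs))
    (solve 4 (λ a b s t → (a :+ b) :+ (s :+ t) := (a :+ s) :+ (b :+ t))
      refl (f x) (g x) (total f xs) (total g xs))

  total-* : ∀ s (f : X → Carrier) xs → total (λ x → s * f x) xs ≈ s * total f xs
  total-* s f List.[]       = sym (zeroʳ s)
  total-* s f (x List.∷ xs) = trans (+-congˡ (total-* s f xs)) (sym (distribˡ s _ _))

  total-1 : ∀ (xs : List X) → total (λ _ → 1#) xs ≈ List.length xs · 1#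
  total-1 List.[]       = refl
  total-1 (x List.∷ xs) = +-congˡ (total-1 xs)

  total-combination : ∀ (a : Fin n → Carrier) (f : Fin n → X → Carrier) xs →
    total (combination K a f) xs ≈ dot a (λ i → total (f i) xs)
  total-combination a f List.[]       = sym (sum-zero λ i → zeroʳ (a i))
  total-combination a f (x List.∷ xs) = begin
    dot a (λ i → f i x) + total (combination K a f) xs
      ≈⟨ +-congˡ (total-combination a f xs) ⟩
    dot a (λ i → f i x) + dot a (λ i → total (f i) xs)
      ≈⟨ ∑-distrib-+ (λ i → a i * f i x) (λ i → a i * total (f i) xs) ⟨
    (sum λ i → a i * f i x + a i * total (f i) xs)
      ≈⟨ sum-cong-≋ (λ i → distribˡ (a i) (f i x) (total (f i) xs)) ⟨
    dot a (λ i → f i x + total (f i) xs) ∎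

  total-integral : ∀ {f : X → Carrier} → (∀ x → Integral (f x)) → ∀ xs → Integral (total f xs)
  total-integral f-int List.[]       = integral-0
  total-integral f-int (x List.∷ xs) = integral-+ (f-int x) (total-integral f-int xs)

  ·1-integral : ∀ n → Integral (n · 1#)
  ·1-integral n = n , 0 , +-identityʳ _

  mean-cong : ∀ {f g : X → Carrier} → (∀ x → f x ≈ g x) → ∀ O → mean f O ≈ mean g O
  mean-cong f≈g (x List⁺.∷ xs) = *-congˡ (total-cong f≈g (x List.∷ xs))

  mean-↭ : ∀ (f : X → Carrier) O O′ → List⁺.toList O ↭ List⁺.toList O′ → mean f O ≈ mean f O′
  mean-↭ {X} f (x List⁺.∷ xs) (y List⁺.∷ ys) p = *-cong
    (reflexive (≡.cong (1/suc K {X} char0) (suc-injective (↭-length p)))) (total-↭ f p)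

  mean-+ : ∀ (f g : X → Carrier) O → mean (λ x → f x + g x) O ≈ mean f O + mean g O
  mean-+ f g (x List⁺.∷ xs) =
    trans (*-congˡ (total-+ f g (x List.∷ xs))) (distribˡ _ _ _)

  mean-* : ∀ s (f : X → Carrier) O → mean (λ x → s * f x) O ≈ s * mean f O
  mean-* {X} s f (x List⁺.∷ xs) = trans (*-congˡ (total-* s f (x List.∷ xs)))
    (solve 3 (λ r s t → r :* (s :* t) := s :* (r :* t))
      refl (1/suc K {X} char0 (List.length xs)) s (total f (x List.∷ xs)))

  mean-neg : ∀ (f : X → Carrier) O → mean (λ x → - f x) O ≈ - mean f O
  mean-neg f O = trans (mean-cong (λ x → sym (-1*x≈-x (f x))) O)
    (trans (mean-* (- 1#) f O) (-1*x≈-x _))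

  mean-1 : ∀ (O : List⁺ X) → mean (λ _ → 1#) O ≈ 1#
  mean-1 {X} (x List⁺.∷ xs) =
    trans (*-congˡ (total-1 (x List.∷ xs))) (1/suc-inverse char0 {X} (List.length xs))

  mean-combination : ∀ (a : Fin n → Carrier) (f : Fin n → X → Carrier) O →
    mean (combination K a f) O ≈ dot a (λ i → mean (f i) O)
  mean-combination {X = X} a f (x List⁺.∷ xs) = begin
    r * total (combination K a f) (x List.∷ xs)
      ≈⟨ *-congˡ (total-combination a f (x List.∷ xs)) ⟩
    r * dot a (λ i → total (f i) (x List.∷ xs))
      ≈⟨ *-distribˡ-sum r (λ i → a i * total (f i) (x List.∷ xs)) ⟩
    (sum λ i → r * (a i * total (f i) (x List.∷ xs)))
      ≈⟨ sum-cong-≋ (λ i → solve 3 (λ r s t → r :* (s :* t) := s :* (r :* t))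
           refl r (a i) (total (f i) (x List.∷ xs))) ⟩
    dot a (λ i → mean (f i) (x List⁺.∷ xs)) ∎
    where
    r = 1/suc K {X} char0 (List.length xs)

  total-mean : ∀ (f : X → Carrier) O → total f (List⁺.toList O) ≈ size# O * mean f O
  total-mean {X} f O@(x List⁺.∷ xs) = sym (begin
    N * (r * S)  ≈⟨ solve 3 (λ n r s → n :* (r :* s) := (r :* n) :* s) refl N r S ⟩
    (r * N) * S  ≈⟨ *-congʳ (1/suc-inverse char0 {X} (List.length xs)) ⟩
    1# * S       ≈⟨ *-identityˡ S ⟩
    S            ∎)
    where
    N = size# O
    r = 1/suc K {X} char0 (List.length xs)
    S = total f (x List.∷ xs)

  size#-cancelˡ : ∀ (O : List⁺ X) {x y} → size# O * x ≈ size# O * y → x ≈ y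
  size#-cancelˡ {X} (z List⁺.∷ zs) {x} {y} e = begin
    x            ≈⟨ *-identityˡ x ⟨
    1# * x       ≈⟨ *-congʳ rN≈1 ⟨
    r * N * x    ≈⟨ *-assoc r N x ⟩
    r * (N * x)  ≈⟨ *-congˡ e ⟩
    r * (N * y)  ≈⟨ *-assoc r N y ⟨
    r * N * y    ≈⟨ *-congʳ rN≈1 ⟩
    1# * y       ≈⟨ *-identityˡ y ⟩
    y            ∎
    where
    N = size# (z List⁺.∷ zs)
    r = 1/suc K {X} char0 (List.length zs)
    rN≈1 : r * N ≈ 1#
    rN≈1 = 1/suc-inverse char0 {X} (List.length zs)

  -- Cross-multiplication trades the factors `1/suc` for integral ones.
  mean-≈⇒totals : ∀ (f : X → Carrier) O O′ → mean f O ≈ mean f O′ →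
    size# O′ * total f (List⁺.toList O) ≈ size# O * total f (List⁺.toList O′)
  mean-≈⇒totals f O O′ e = begin
    N′ * total f (List⁺.toList O)    ≈⟨ *-congˡ (total-mean f O) ⟩
    N′ * (N * mean f O)              ≈⟨ *-congˡ (*-congˡ e) ⟩
    N′ * (N * mean f O′)             ≈⟨ solve 3 (λ a b x → a :* (b :* x) := b :* (a :* x))
                                          refl N′ N (mean f O′) ⟩
    N * (N′ * mean f O′)             ≈⟨ *-congˡ (total-mean f O′) ⟨
    N * total f (List⁺.toList O′)    ∎
    where
    N = size# O
    N′ = size# O′

  totals⇒mean-≈ : ∀ (f : X → Carrier) O O′ →
    size# O′ * total f (List⁺.toList O) ≈ size# O * total f (List⁺.toList O′) →
    mean f O ≈ mean f O′
  totals⇒mean-≈ f O O′ e = size#-cancelˡ O (size#-cancelˡ O′ (begin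
    N′ * (N * mean f O)              ≈⟨ *-congˡ (total-mean f O) ⟨
    N′ * total f (List⁺.toList O)    ≈⟨ e ⟩
    N * total f (List⁺.toList O′)    ≈⟨ *-congˡ (total-mean f O′) ⟩
    N * (N′ * mean f O′)             ≈⟨ solve 3 (λ a b x → a :* (b :* x) := b :* (a :* x))
                                          refl N N′ (mean f O′) ⟩
    N′ * (N * mean f O′)             ∎))
    where
    N = size# O
    N′ = size# O′

  -- A reference list `O₀` stands in for the unknown constant of homomesy and makes the condition
  -- homogeneous in the coefficients.
  EqualMeans : ∀ {m} → (Fin m → List⁺ X) → List⁺ X → (X → Carrier) → Set _
  EqualMeans O O₀ f = ∀ k → mean f (O k) ≈ mean f O₀

  equal-means-dimension : ∀ {m} (f : Fin n → X → Carrier) → (∀ i x → Integral (f i x)) →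
    (O : Fin m → List⁺ X) (O₀ : List⁺ X) →
    ∃[ d ] HasDimension K (λ a → EqualMeans O O₀ (combination K a f)) d
  equal-means-dimension {n = n} {X = X} {m = m} f f-int O O₀ =
    let (d , b , _ , b∈ , b-indep , b-spans) = kernel-basis char0 rows rows-integral
    in  d , HasDimension-resp kernel⇒means means⇒kernel (b , b∈ , b-indep , b-spans)
    where
    totals : List⁺ X → Fin n → Carrier
    totals P i = total (f i) (List⁺.toList P)
    -- The equation mean (O k) = mean O₀, with denominators cleared to keep it integral.
    rows : Fin m → Fin n → Carrier
    rows k i = size# O₀ * totals (O k) i + - size# (O k) * totals O₀ i
    rows-integral : ∀ k i → Integral (rows k i)
    rows-integral k i = integral-+
      (integral-* (·1-integral (List⁺.length O₀)) (total-integral (f-int i) (List⁺.toList (O k))))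
      (integral-* (integral-neg (·1-integral (List⁺.length (O k))))
        (total-integral (f-int i) (List⁺.toList O₀)))
    rows-dot : ∀ k a → dot (rows k) a ≈
      size# O₀ * total (combination K a f) (List⁺.toList (O k))
      - size# (O k) * total (combination K a f) (List⁺.toList O₀)
    rows-dot k a = begin
      dot (rows k) a
        ≈⟨ dot-comm (rows k) a ⟩
      dot a (rows k)
        ≈⟨ dot-linear a (size# O₀) (totals (O k)) (- size# (O k)) (totals O₀) ⟩
      size# O₀ * dot a (totals (O k)) + - size# (O k) * dot a (totals O₀)
        ≈⟨ +-cong (*-congˡ (total-combination a f (List⁺.toList (O k))))
                  (*-congˡ (total-combination a f (List⁺.toList O₀))) ⟨
      size# O₀ * total (combination K a f) (List⁺.toList (O k))
        + - size# (O k) * total (combination K a f) (List⁺.toList O₀)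
        ≈⟨ +-congˡ (-‿distribˡ-* _ _) ⟨
      size# O₀ * total (combination K a f) (List⁺.toList (O k))
        - size# (O k) * total (combination K a f) (List⁺.toList O₀) ∎
    kernel⇒means : ∀ a → Kernel rows a → EqualMeans O O₀ (combination K a f)
    kernel⇒means a a∈ k = totals⇒mean-≈ (combination K a f) (O k) O₀
      (x∙y⁻¹≈ε⇒x≈y _ _ (trans (sym (rows-dot k a)) (a∈ k)))
    means⇒kernel : ∀ a → EqualMeans O O₀ (combination K a f) → Kernel rows a
    means⇒kernel a e k = trans (rows-dot k a)
      (x≈y⇒x∙y⁻¹≈ε (mean-≈⇒totals (combination K a f) (O k) O₀ (e k)))

-- Homomesic statistics on a fence

module FenceHomomesy {c ℓ₁ ℓ₂ : Level} (K : HeytingField c ℓ₁ ℓ₂) (char0 : CharacteristicZero K)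
  (F : Fence) where
  open LinearAlgebra K
  open Averages K char0
  open FenceOrder F
  open FenceOrbits F

  Stat : Set c
  Stat = Statistic K F

  antichain ideal-indicator : Element F → Stat
  antichain       = χ K F
  ideal-indicator = χ̂ K F

  Hom : Stat → Set _
  Hom = Homomesic K F char0

  Hom-resp : ∀ {f g} → _≐_ K f g → Hom f → Hom g
  Hom-resp f≐g (m , h) = m , λ O O-orbit → trans (sym (mean-cong f≐g O)) (h O O-orbit)

  indicator-yes : ∀ {P : Set} (d : Dec P) → P → indicator K F d ≈ 1#
  indicator-yes d p rewrite dec-true d p = refl

  indicator-no : ∀ {P : Set} (d : Dec P) → ¬ P → indicator K F d ≈ 0#
  indicator-no d ¬p rewrite dec-false d ¬p = refl

  indicator-⇔ : ∀ {P Q : Set} (d : Dec P) (e : Dec Q) → (P → Q) → (Q → P) →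
    indicator K F d ≈ indicator K F e
  indicator-⇔ (yes p) e to _   = sym (indicator-yes e (to p))
  indicator-⇔ (no ¬p) e _ from = sym (indicator-no e (¬p ∘ from))

  indicator-⊎ : ∀ {P Q R : Set} (d : Dec P) (e : Dec Q) (f : Dec R) →
    (Q → P) → (R → P) → (Q → ¬ R) → (P → ¬ R → Q) →
    indicator K F d ≈ indicator K F e + indicator K F f
  indicator-⊎ d e (yes r) Q⇒P R⇒P disjoint cover =
    trans (indicator-yes d (R⇒P r))
      (sym (trans (+-congʳ (indicator-no e λ q → disjoint q r)) (+-identityˡ 1#)))
  indicator-⊎ d e (no ¬r) Q⇒P R⇒P disjoint cover =
    trans (indicator-⇔ d e (λ p → cover p ¬r) Q⇒P) (sym (+-identityʳ _))

  indicator-complement : ∀ {P Q : Set} (d : Dec P) (e : Dec Q) → (P → ¬ Q) → (¬ Q → P) →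
    indicator K F d + indicator K F e ≈ 1#
  indicator-complement d (yes q) disjoint _ =
    trans (+-congʳ (indicator-no d λ p → disjoint p q)) (+-identityˡ 1#)
  indicator-complement d (no ¬q) _ cover =
    trans (+-identityʳ _) (indicator-yes d (cover ¬q))

  indicator-integral : ∀ {P : Set} (d : Dec P) → Integral (indicator K F d)
  indicator-integral d with does d
  ... | true  = integral-1
  ... | false = integral-0

  minimal-≼ : ∀ {v} → (∀ y → ¬ y ≺ v) → ∀ {x} → x ≼ v → x ≡ v
  minimal-≼ v-min ε       = ≡.refl
  minimal-≼ v-min (c ◅ p) with ≡.refl ← minimal-≼ v-min p = contradiction c (v-min _)

  Max? : ∀ I q → Dec (Max I q)
  Max? I = maximal? F (_∈? set I)

  maximal-relation : ∀ {q} → (∀ y → ¬ q ≺ y) → ∀ I → ideal-indicator q I ≈ antichain q I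
  maximal-relation {q} q-max I = indicator-⇔ (q ∈? set I) (Max? I q)
    (λ q∈ → q∈ , λ { y y∈ ε → ≡.refl ; y y∈ (c ◅ _) → contradiction c (q-max _) }) proj₁

  -- Everything strictly above `q` is above `r`, so for `q` in `I` either `r` is in `I` or `q` is
  -- maximal in `I`, and not both.
  one-up-relation : ∀ {q r} → q ≺ r → (∀ y → q ≺ y → y ≡ r) → ∀ I →
    ideal-indicator q I ≈ antichain q I + ideal-indicator r I
  one-up-relation {q} {r} q≺r unique I = indicator-⊎ (q ∈? set I) (Max? I q) (r ∈? set I)
    proj₁ (down-closed I (q≺r ◅ ε)) disjoint λ q∈ r∉ → q∈ , top r∉
    where
    disjoint : Max I q → ¬ r ∈ set I
    disjoint (_ , top) r∈ with ≡.refl ← top r r∈ (q≺r ◅ ε) = ≺-irrefl q≺r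
    top : ¬ r ∈ set I → ∀ y → y ∈ set I → q ≼ y → q ≡ y
    top r∉ y y∈ ε       = ≡.refl
    top r∉ y y∈ (c ◅ p) with ≡.refl ← unique _ c = contradiction (down-closed I p y∈) r∉

  -- Being maximal in `ρ F I` means being minimal in the complement of `I`; for an element minimal
  -- in the whole fence this only says that it is not in `I`.
  minimal-relation : ∀ {q} → (∀ y → ¬ y ≺ q) → ∀ I →
    antichain q (ρ F I) + ideal-indicator q I ≈ 1#
  minimal-relation {q} q-min I = indicator-complement (Max? (ρ F I) q) (q ∈? set I)
    (λ q-top → proj₁ (Max-ρ⇒Min∁ {I} q-top))
    (λ q∉ → Min∁⇒Max-ρ {I} (q∉ , λ y _ y≼q → ≡.sym (minimal-≼ q-min y≼q)))

  -- Rowmotion merely reorders the summands. This brings the two terms of `minimal-relation`, taken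
  -- at different ideals, into one average.
  mean-ρ : ∀ (f : Stat) O → IsOrbit F O → mean (f ∘ ρ F) O ≈ mean f O
  mean-ρ f O@(x List⁺.∷ xs) O-orbit = *-congˡ (trans
    (sym (total-map f (ρ F) (x List.∷ xs))) (total-↭ f (ρ-permutes-orbit O O-orbit)))

  -- The φ_q above, with offset-at the difference of the averages of χ_q and φ_q.
  adjusted-at : ∀ {q} → Shape q → Stat
  adjusted-at {q} (maximal _)    = antichain q
  adjusted-at {q} (one-up _ _ _) = antichain q
  adjusted-at {q} (minimal _)    = λ I → - ideal-indicator q I

  offset-at : ∀ {q} → Shape q → Carrier
  offset-at (maximal _)    = 0#
  offset-at (one-up _ _ _) = 0#
  offset-at (minimal _)    = 1#

  adjusted : Element F → Stat
  adjusted q = adjusted-at (shape q)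

  offset : Element F → Carrier
  offset q = offset-at (shape q)

  mean-antichain : ∀ {q} (s : Shape q) O → IsOrbit F O →
    mean (antichain q) O ≈ mean (adjusted-at s) O + offset-at s
  mean-antichain (maximal _)    O _ = sym (+-identityʳ _)
  mean-antichain (one-up _ _ _) O _ = sym (+-identityʳ _)
  mean-antichain {q} (minimal q-min) O O-orbit = begin
    A                     ≈⟨ +-identityʳ A ⟨
    A + 0#                ≈⟨ +-congˡ (-‿inverseʳ B) ⟨
    A + (B - B)           ≈⟨ +-assoc A B (- B) ⟨
    (A + B) - B           ≈⟨ +-cong A+B≈1 (sym (mean-neg (ideal-indicator q) O)) ⟩
    1# + mean (λ I → - ideal-indicator q I) O  ≈⟨ +-comm _ _ ⟩
    mean (λ I → - ideal-indicator q I) O + 1#  ∎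
    where
    A = mean (antichain q) O
    B = mean (ideal-indicator q) O
    A+B≈1 : A + B ≈ 1#
    A+B≈1 = begin
      A + B                                           ≈⟨ +-congʳ (mean-ρ (antichain q) O O-orbit) ⟨
      mean (antichain q ∘ ρ F) O + B                  ≈⟨ mean-+ (antichain q ∘ ρ F) (ideal-indicator q) O ⟨
      mean (λ I → antichain q (ρ F I) + ideal-indicator q I) O
                                                      ≈⟨ mean-cong (minimal-relation q-min) O ⟩
      mean (λ _ → 1#) O                               ≈⟨ mean-1 O ⟩
      1#                                              ∎

  -- The shift `dot a offset` depends on the coefficients but not on the orbit, so one side is
  -- constant over orbits exactly when the other is.
  mean-combinations : ∀ a O → IsOrbit F O →
    mean (combination K a antichain) O ≈ mean (combination K a adjusted) O + dot a offset
  mean-combinations a O O-orbit = begin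
    mean (combination K a antichain) O
      ≈⟨ mean-combination a antichain O ⟩
    dot a (λ q → mean (antichain q) O)
      ≈⟨ sum-cong-≋ (λ q → trans (*-congˡ (mean-antichain (shape q) O O-orbit)) (distribˡ (a q) _ _)) ⟩
    (sum λ q → a q * mean (adjusted q) O + a q * offset q)
      ≈⟨ ∑-distrib-+ (λ q → a q * mean (adjusted q) O) (λ q → a q * offset q) ⟩
    dot a (λ q → mean (adjusted q) O) + dot a offset
      ≈⟨ +-congʳ (mean-combination a adjusted O) ⟨
    mean (combination K a adjusted) O + dot a offset ∎

  Hom-antichain⇒adjusted : ∀ a → Hom (combination K a antichain) → Hom (combination K a adjusted)
  Hom-antichain⇒adjusted a (m , h) = m - dot a offset , λ O O-orbit →
    +-cancelʳ (dot a offset) _ _ (begin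
      mean (combination K a adjusted) O + dot a offset  ≈⟨ mean-combinations a O O-orbit ⟨
      mean (combination K a antichain) O                ≈⟨ h O O-orbit ⟩
      m                                                 ≈⟨ +-identityʳ m ⟨
      m + 0#                                            ≈⟨ +-congˡ (-‿inverseˡ _) ⟨
      m + (- dot a offset + dot a offset)               ≈⟨ +-assoc _ _ _ ⟨
      m - dot a offset + dot a offset                   ∎)

  Hom-adjusted⇒antichain : ∀ a → Hom (combination K a adjusted) → Hom (combination K a antichain)
  Hom-adjusted⇒antichain a (m , h) = m + dot a offset , λ O O-orbit →
    trans (mean-combinations a O O-orbit) (+-congʳ (h O O-orbit))

  antichain-↓ : ∀ {p q} → p ≢ q → antichain p (↓ q) ≈ 0#
  antichain-↓ {p} {q} p≢q = indicator-no (Max? (↓ q) p) (p≢q ∘ Max-↓⇒≡)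

  antichain-↓-self : ∀ q → antichain q (↓ q) ≈ 1#
  antichain-↓-self q = indicator-yes (Max? (↓ q) q) (Max-↓ q)

  -- Evaluation at `↓ q` kills every χ_p except χ_q.
  antichain-independent : LinearlyIndependent K antichain
  antichain-independent a a-zero q = begin
    a q                                    ≈⟨ *-identityʳ (a q) ⟨
    a q * 1#                               ≈⟨ *-congˡ (antichain-↓-self q) ⟨
    a q * antichain q (↓ q)                ≈⟨ sum-single q (λ p p≢q →
                                                trans (*-congˡ (antichain-↓ p≢q)) (zeroʳ (a p))) ⟨
    combination K a antichain (↓ q)        ≈⟨ a-zero (↓ q) ⟩
    0#                                     ∎

  adjusted-↓-self : ∀ {q} (s : Shape q) → Invertible (adjusted-at s (↓ q))
  adjusted-↓-self {q} (maximal _)    = 1# , trans (*-identityˡ _) (antichain-↓-self q)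
  adjusted-↓-self {q} (one-up _ _ _) = 1# , trans (*-identityˡ _) (antichain-↓-self q)
  adjusted-↓-self {q} (minimal _)    = - 1# , (begin
    - 1# * - ideal-indicator q (↓ q)   ≈⟨ -1*x≈-x _ ⟩
    - - ideal-indicator q (↓ q)        ≈⟨ -‿involutive _ ⟩
    ideal-indicator q (↓ q)            ≈⟨ indicator-yes (q ∈? set (↓ q)) (↓-members⁻ ε) ⟩
    1#                                 ∎)

  -- Principal ideals of minimal elements isolate the coefficients of the minimal
  -- elements; after that those of the others are isolated as for antichains.
  adjusted-independent : LinearlyIndependent K adjusted
  adjusted-independent a a-zero q = isolate q λ p p≢q → off p p≢q (shape p)
    where
    isolate : ∀ q → (∀ p → p ≢ q → a p * adjusted p (↓ q) ≈ 0#) → a q ≈ 0#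
    isolate q off = cancel-unit (adjusted-↓-self (shape q))
      (trans (sym (sum-single {f = λ p → a p * adjusted p (↓ q)} q off)) (a-zero (↓ q)))
    vanish : ∀ {p v} → (∀ y → ¬ y ≺ v) → p ≢ v → (s : Shape p) → adjusted-at s (↓ v) ≈ 0#
    vanish _ p≢v (maximal _)    = antichain-↓ p≢v
    vanish _ p≢v (one-up _ _ _) = antichain-↓ p≢v
    vanish {p} {v} v-min p≢v (minimal _) = trans
      (-‿cong (indicator-no (p ∈? set (↓ v)) (p≢v ∘ minimal-≼ v-min ∘ ↓-members))) -0#≈0#
    minimal-zero : ∀ v → (∀ y → ¬ y ≺ v) → a v ≈ 0#
    minimal-zero v v-min = isolate v λ p p≢v → trans (*-congˡ (vanish v-min p≢v (shape p))) (zeroʳ (a p))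
    off : ∀ p → p ≢ q → (s : Shape p) → a p * adjusted-at s (↓ q) ≈ 0#
    off p p≢q (maximal _)    = trans (*-congˡ (antichain-↓ p≢q)) (zeroʳ (a p))
    off p p≢q (one-up _ _ _) = trans (*-congˡ (antichain-↓ p≢q)) (zeroʳ (a p))
    off p p≢q (minimal p-min) = trans (*-congʳ (minimal-zero p p-min)) (zeroˡ _)

  adjusted-in-Span : ∀ {q} (s : Shape q) → Span K ideal-indicator (adjusted-at s)
  adjusted-in-Span {q} (maximal q-max) =
    Span-resp (maximal-relation q-max) (Span-element ideal-indicator q)
  adjusted-in-Span {q} (minimal _) = Span-neg (Span-element ideal-indicator q)
  adjusted-in-Span {q} (one-up r q≺r unique) = Span-resp difference
    (Span-+ (Span-element ideal-indicator q) (Span-neg (Span-element ideal-indicator r)))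
    where
    difference : ∀ I → ideal-indicator q I - ideal-indicator r I ≈ antichain q I
    difference I = begin
      ideal-indicator q I - ideal-indicator r I
        ≈⟨ +-congʳ (one-up-relation q≺r unique I) ⟩
      antichain q I + ideal-indicator r I - ideal-indicator r I
        ≈⟨ +-assoc _ _ _ ⟩
      antichain q I + (ideal-indicator r I - ideal-indicator r I)
        ≈⟨ +-congˡ (-‿inverseʳ _) ⟩
      antichain q I + 0#
        ≈⟨ +-identityʳ _ ⟩
      antichain q I ∎

  -- Induction from the top of the poset: `one-up-relation` reduces χ̂_q to χ̂_r for an `r` strictly
  -- above `q`.
  ideal-indicator-in-Span : ∀ q → Span K adjusted (ideal-indicator q)
  ideal-indicator-in-Span q = go q (po-noetherian ≼-isPartialOrder q)
    where
    go : ∀ q → Acc _ q → Span K adjusted (ideal-indicator q)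
    -- The span membership is passed along with `shape q`, so that matching on the shape also
    -- computes `adjusted q` in its type.
    go q (acc rs) = step (shape q) (Span-element adjusted q)
      where
      step : (s : Shape q) → Span K adjusted (adjusted-at s) → Span K adjusted (ideal-indicator q)
      step (maximal q-max) e = Span-resp (λ I → sym (maximal-relation q-max I)) e
      step (one-up r q≺r unique) e = Span-resp (λ I → sym (one-up-relation q≺r unique I))
        (Span-+ e (go r (rs (q≺r ◅ ε , λ q≡r → ≺-irrefl (≡.subst (q ≺_) (≡.sym q≡r) q≺r)))))
      step (minimal _) e = Span-resp (λ I → -‿involutive _) (Span-neg e)

  HomCoefficients : (Element F → Stat) → (Element F → Carrier) → Set _
  HomCoefficients e a = Hom (combination K a e)

  -- Every orbit is a permutation of some `O k` and so has the same mean; the constant of homomesy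
  -- is the mean over `O₀`.
  coefficient-dimension : ∀ {m} (e : Element F → Stat) → (∀ q I → Integral (e q I)) →
    (O : Fin m → List⁺ Ideal) → (∀ k → IsOrbit F (O k)) →
    (O₀ : List⁺ Ideal) → IsOrbit F O₀ →
    (∀ P → IsOrbit F P → ∃[ k ] List⁺.toList P ↭ List⁺.toList (O k)) →
    ∃[ d ] HasDimension K (HomCoefficients e) d
  coefficient-dimension e e-int O O-orbit O₀ O₀-orbit complete =
    let (d , h) = equal-means-dimension e e-int O O₀
    in  d , HasDimension-resp
      (λ a equal → mean (combination K a e) O₀ , λ P P-orbit →
        let (k , p) = complete P P-orbit
        in  trans (mean-↭ (combination K a e) P (O k) p) (equal k))
      (λ a (_ , means) k → trans (means (O k) (O-orbit k)) (sym (means O₀ O₀-orbit))) h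

  orbits-complete : ∀ P → IsOrbit F P →
    ∃[ k ] List⁺.toList P ↭ List⁺.toList (orbit (decode k))
  orbits-complete P P-orbit@(_ , I , _) = encode I ,
    ≡.subst (λ J → List⁺.toList P ↭ List⁺.toList (orbit J))
      (≡.sym (decode-encode I)) (isOrbit-↭ P P-orbit)

  -- Its orbit is the reference orbit; any other ideal would serve.
  ∅ : Ideal
  ∅ = ⟨_⟩ F {λ _ → ⊥} λ _ → no λ ()

  antichain-dimension : ∃[ d ] HasDimension K (HomCoefficients antichain) d
  antichain-dimension = coefficient-dimension antichain
    (λ q I → indicator-integral (Max? I q))
    (λ k → orbit (decode k)) (λ k → orbit-isOrbit (decode k))
    (orbit ∅) (orbit-isOrbit ∅) orbits-complete

  -- `adjusted` has the span of the χ̂'s and the homomesic coefficient vectors of the χ's, so the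
  -- basis in `h` serves here too, with the same `d`.
  I-H-dimension : ∀ {d} → HasDimension K (HomCoefficients antichain) d →
    HasDimension K (I-H K F char0) d
  I-H-dimension h = HasDimension-resp {P = λ f → Span K adjusted f × Hom f}
    (λ f (f∈ , f-hom) → Span-trans (λ q → adjusted-in-Span (shape q)) f∈ , f-hom)
    (λ f (f∈ , f-hom) → Span-trans ideal-indicator-in-Span f∈ , f-hom)
    (HasDimension-Span {e = adjusted} {H = Hom} adjusted-independent (λ {f} {g} → Hom-resp {f} {g})
      (HasDimension-resp {P = HomCoefficients antichain} {Q = HomCoefficients adjusted}
        Hom-antichain⇒adjusted Hom-adjusted⇒antichain h))

  A-H-dimension : ∀ {d} → HasDimension K (HomCoefficients antichain) d →
    HasDimension K (A-H K F char0) d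
  A-H-dimension h = HasDimension-Span {e = antichain} {H = Hom}
    antichain-independent (λ {f} {g} → Hom-resp {f} {g}) h

theorem7p1 : ∀ {c ℓ₁ ℓ₂} (K : HeytingField c ℓ₁ ℓ₂) (char0 : CharacteristicZero K) (F : Fence) →
    ∃[ d ] (HasDimension K (I-H K F char0) d × HasDimension K (A-H K F char0) d)
theorem7p1 K char0 F =
  let open FenceHomomesy K char0 F
      (d , h) = antichain-dimension
  in  d , I-H-dimension h , A-H-dimension h
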